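{- Let $q$ be a prime power and $n$ a positive integer. Then $\mathcal{C}(n,q)$ is a binary linear code of length $q^{\frac{n(n+1)}{2}}$ and dimension $k_1\le q^{\frac{n^2-n}{2}}(q-1)^n$, and $\mathcal{C}^T(n,q)$ is a binary linear code of length $\frac{q^n-1}{q-1}q^{\frac{n^2+n-2}{2}}$ and dimension $k_2\le \frac{q^n-1}{q-1}q^{\frac{n^2+n-2}{2}}-q^{\frac{n(n+1)}{2}}+q^{\frac{n^2-n}{2}}(q-1)^n$.
   Context: $\mathbb{S}_n(\mathbb{F}_q)$ denotes the set of $n\times n$ symmetric matrices over $\mathbb{F}_q$ (its elements are called points). Two points $S,S'$ are adjacent if $\operatorname{rank}(S-S')=1$. A line is a maximal set of rank $1$: a subset $\mathcal{M}\subseteq\mathbb{S}_n(\mathbb{F}_q)$ such that any two distinct points of $\mathcal{M}$ are adjacent and no point outside $\mathcal{M}$ is adjacent to every point of $\mathcal{M}$. $H(n,q)$ is the binary matrix with rows indexed by the lines and columns indexed by the points, whose (line, point) entry is $1$ iff the point belongs to the line. $\mathcal{C}(n,q)=\{c\in\mathbb{F}_2^{\text{points}}: H(n,q)c=0\}$ and $\mathcal{C}^T(n,q)=\{c\in\mathbb{F}_2^{\text{lines}}: H(n,q)^Tc=0\}$. -}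

module Defs where

open import Data.Nat using (ℕ; zero; suc; _<_; _^_; _*_)
open import Data.Nat.Primality using (Prime)
open import Data.Fin using (Fin)
open import Data.Fin.Properties using (_≟_)
open import Data.Bool using (Bool; true; false; _∧_; _xor_; T)
open import Data.Unit using (tt)
open import Data.Vec using (Vec; []; _∷_; lookup; tabulate; map; foldr; zipWith)
open import Data.List using (List; []; _∷_; allFin; mapMaybe; concatMap)
import Data.List as L
open import Data.Bool.ListAction using (and)
open import Data.Maybe using (Maybe; just; nothing)
open import Data.Product using (Σ; ∃; ∃-syntax; _×_; _,_)
open import Relation.Nullary using (¬_; does)
open import Relation.Binary.PropositionalEquality using (_≡_; _≢_; subst; sym)
open import Algebra.Structures using (IsCommutativeRing)
open import Algebra.Core using (Op₁; Op₂)

IsPrimePower : ℕ → Set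
IsPrimePower q = ∃[ p ] ∃[ k ] (Prime p × 0 < k × q ≡ p ^ k)

xorSum : ∀ {A : Set} → List A → (A → Bool) → Bool
xorSum xs f = L.foldr (λ x b → f x xor b) false xs

-- A field structure on the q-element set Fin q (any finite field of
-- order q is, up to isomorphism, of this form).

record FieldOn (q : ℕ) : Set where
  infixl 6 _+_
  infixl 7 _·_
  field
    _+_ : Op₂ (Fin q)
    _·_ : Op₂ (Fin q)
    -_  : Op₁ (Fin q)
    0#  : Fin q
    1#  : Fin q
    isCommutativeRing : IsCommutativeRing _≡_ _+_ _·_ -_ 0# 1#
    0≢1 : 0# ≢ 1#
    inverse : ∀ x → x ≢ 0# → ∃[ y ] (x · y ≡ 1#)

module Matrices {q : ℕ} (𝔽 : FieldOn q) where
  open FieldOn 𝔽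

  Mat : ℕ → ℕ → Set
  Mat m k = Vec (Vec (Fin q) k) m

  entry : ∀ {m k} → Mat m k → Fin m → Fin k → Fin q
  entry M i j = lookup (lookup M i) j

  sumF : ∀ {r} → Vec (Fin q) r → Fin q
  sumF = foldr _ _+_ 0#

  _⊗_ : ∀ {m r k} → Mat m r → Mat r k → Mat m k
  A ⊗ B = tabulate λ i → tabulate λ j →
            sumF (tabulate λ l → entry A i l · entry B l j)

  _⊖_ : ∀ {m k} → Mat m k → Mat m k → Mat m k
  A ⊖ B = zipWith (zipWith (λ x y → x + (- y))) A B

  RankAtMost : ∀ {m k} → ℕ → Mat m k → Set
  RankAtMost {m} {k} r M = ∃[ A ] ∃[ B ] (M ≡ (_⊗_ {m} {r} {k} A B))

  HasRank : ∀ {m k} → Mat m k → ℕ → Set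
  HasRank M r = RankAtMost r M × (∀ s → s < r → ¬ RankAtMost s M)

  isSymᵇ : ∀ {n} → Mat n n → Bool
  isSymᵇ {n} M = and (L.map (λ i → and (L.map (λ j → does (entry M i j ≟ entry M j i)) (allFin n))) (allFin n))

  Point : ℕ → Set
  Point n = Σ (Mat n n) (λ M → T (isSymᵇ M))

  -- explicit enumeration of all matrices / points (each exactly once)
  allVecs : ∀ {A : Set} k → List A → List (Vec A k)
  allVecs zero xs = [] ∷ []
  allVecs (suc k) xs = concatMap (λ x → L.map (x ∷_) (allVecs k xs)) xs

  allMats : ∀ n → List (Mat n n)
  allMats n = allVecs n (allVecs n (allFin q))

  toPoint : ∀ {n} → Mat n n → Maybe (Point n)
  toPoint M with isSymᵇ M in e
  ... | true  = just (M , subst T (sym e) tt)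
  ... | false = nothing

  allPoints : ∀ n → List (Point n)
  allPoints n = mapMaybe toPoint (allMats n)

  Adjacent : ∀ {n} → Point n → Point n → Set
  Adjacent (S , _) (S' , _) = HasRank (S ⊖ S') 1

  IsLine : ∀ {n} → (Point n → Bool) → Set
  IsLine {n} P =
    (∀ S S' → P S ≡ true → P S' ≡ true → S ≢ S' → Adjacent S S')
    × (∀ T' → P T' ≡ false → ¬ (∀ S → P S ≡ true → Adjacent T' S))

  IsLineEnumeration : ∀ {n} m → (Fin m → Point n → Bool) → Set
  IsLineEnumeration {n} m Ln =
    (∀ i → IsLine (Ln i))
    × (∀ i j → (∀ S → Ln i S ≡ Ln j S) → i ≡ j)
    × (∀ P → IsLine P → ∃[ i ] (∀ S → P S ≡ Ln i S))

  -- the codes C(n,q) and C^T(n,q) (kernels of H and H^T over F₂)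
  CodeC : ∀ {n m} → (Fin m → Point n → Bool) → (Point n → Bool) → Set
  CodeC {n} {m} Ln c = ∀ i → xorSum (allPoints n) (λ S → Ln i S ∧ c S) ≡ false

  CodeCT : ∀ {n m} → (Fin m → Point n → Bool) → (Fin m → Bool) → Set
  CodeCT {n} {m} Ln c = ∀ S → xorSum (allFin m) (λ i → Ln i S ∧ c i) ≡ false

-- Binary linear codes with coordinates indexed by a type X
-- (words are functions X → Bool, compared pointwise)

module _ {X : Set} where

  zeroW : X → Bool
  zeroW _ = false

  _⊕_ : (X → Bool) → (X → Bool) → (X → Bool)
  (c ⊕ d) x = c x xor d x

  IsLinearCode : ((X → Bool) → Set) → Set
  IsLinearCode C =
    C zeroW
    × (∀ c d → C c → C d → C (c ⊕ d))
    × (∀ c d → C c → (∀ x → c x ≡ d x) → C d)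

  lincomb : ∀ {k} → (Fin k → Bool) → (Fin k → X → Bool) → X → Bool
  lincomb {k} a b x = xorSum (allFin k) (λ i → a i ∧ b i x)

  HasDimension : ((X → Bool) → Set) → ℕ → Set
  HasDimension C k = Σ (Fin k → X → Bool) λ b →
    (∀ i → C (b i))
    × (∀ a → (∀ x → lincomb a b x ≡ false) → ∀ i → a i ≡ false)
    × (∀ c → C c → ∃[ a ] (∀ x → c x ≡ lincomb a b x))

{-# OPTIONS --safe #-}

-- Over a field every symmetric matrix of rank 1 is x v vᵀ, and S + x v vᵀ, S + y w wᵀ (x, y ≠ 0)
-- are adjacent only for parallel v and w, so lines are the sets {S + x v vᵀ : x ∈ F_q}.
-- Both dimension bounds only use the lines in the coordinate directions, which change one
-- diagonal entry. Attach to each point S with a zero on the diagonal the coordinate line ℓ(S)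
-- through S at its first zero diagonal entry. The other points of ℓ(S) have their first zero
-- later or none at all, so the incidence matrix of points with a zero against the lines ℓ(S) is
-- triangular. Hence a word of C is determined by its values on the q^(n(n-1)/2) (q-1)^n points
-- with nonzero diagonal, and a word of Cᵀ by its values on the lines not of the form ℓ(S).
module Submission where

open import Defs
open import Data.Nat using (ℕ; zero; suc; pred; _+_; _*_; _∸_; _^_; _≤_; _<_; s≤s; z≤n)
open import Data.Nat.DivMod using (_/_; m*n/n≡m)
open import Data.Nat.Solver using (module +-*-Solver)
import Data.Nat.Properties as ℕₚ
open import Data.Fin using (Fin; zero; suc; punchIn; punchOut; combine; funToFin; finToFun)
import Data.Fin as Fin
import Data.Fin.Properties as Finₚ
open import Data.Fin.Induction using (<-wellFounded; >-wellFounded)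
open import Data.Fin.Subset.Properties using (anySubset?)
open import Induction.WellFounded using (Acc; acc)
open import Data.Bool using (Bool; true; false; _∧_; _xor_; T)
open import Data.Bool.ListAction using (and)
import Data.Bool.Properties as Boolₚ
open import Data.Empty using (⊥; ⊥-elim)
open import Data.Maybe using (Maybe; just; nothing; maybe′)
open import Data.Unit using (⊤; tt)
open import Data.Vec using (Vec; []; _∷_; lookup; tabulate; insertAt; removeAt)
import Data.Vec as V
import Data.Vec.Properties as Vecₚ
open import Data.List using (List; []; _∷_; length; allFin; mapMaybe)
import Data.List as L
import Data.List.Properties as Listₚ
open import Data.List.Membership.Propositional using (_∈_)
import Data.List.Membership.Propositional.Properties as ∈ₚ
open import Data.List.Relation.Unary.Any as Any using (here; there)
open import Data.List.Relation.Unary.All as All using ([]; _∷_)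
import Data.List.Relation.Unary.All.Properties as Allₚ
open import Data.List.Relation.Unary.AllPairs as AllPairs using ([]; _∷_)
import Data.List.Relation.Unary.AllPairs.Properties as AllPairsₚ
open import Data.List.Relation.Unary.Unique.Propositional using (Unique)
import Data.List.Relation.Unary.Unique.Propositional.Properties as Uniqueₚ
open import Data.Product using (Σ; ∃; Σ-syntax; ∃-syntax; _×_; _,_; proj₁; proj₂)
open import Data.Product.Function.NonDependent.Propositional using (_×-↔_)
open import Data.Sum using (_⊎_; inj₁; inj₂)
open import Data.Sum.Properties using (inj₁-injective)
open import Data.Sum.Function.Propositional using (_⊎-↔_)
open import Function using (_∘_; id)
open import Function.Bundles using (_↔_; Inverse; Equivalence; mk↔ₛ′)
open import Function.Properties.Inverse using (↔-refl; ↔-sym; ↔-trans)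
open import Level using (0ℓ)
open import Relation.Nullary using (Dec; yes; no; ¬_; does)
open import Relation.Nullary.Decidable using (map′; _×-dec_; dec-true; ¬?)
open import Relation.Binary.PropositionalEquality
open import Algebra.Bundles using (CommutativeRing)
import Algebra.Properties.Ring
import Algebra.Solver.Ring.NaturalCoefficients.Default as Solver
open import Algebra.Properties.CommutativeSemigroup
  (CommutativeRing.+-commutativeSemigroup Boolₚ.xor-∧-commutativeRing)
  using () renaming (interchange to xor-interchange)

-- Triangularity with ones on the diagonal makes the chosen submatrix invertible whatever the
-- coefficients, so it does not matter that the points come from F_q while the codes live over F₂.
-- Its size is the number of points with a zero on the diagonal, q^(n(n+1)/2) - q^(n(n-1)/2)
-- (q-1)^n, and subtracting this from the number of points and from the number of lines gives the
-- two bounds; for the second, S ↦ ℓ(S) has to be injective, which is again triangularity. The two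
-- codes solve the system in opposite orders. For C the first zero position decreases, because the
-- other points of ℓ(S) have a later first zero or none. For Cᵀ it increases, because any other
-- chosen line ℓ(S′) through S comes from a point S′ with an earlier first zero. A dimension has to
-- come with an explicit basis, so rank and nullity are replaced by information sets: coordinates on
-- which only the zero word vanishes are at least as many as the dimension.

-- Sums over F₂ and linear codes given as kernels

xorSum-cong : {A : Set} (xs : List A) {f g : A → Bool} →
  (∀ x → f x ≡ g x) → xorSum xs f ≡ xorSum xs g
xorSum-cong []       e = refl
xorSum-cong (x ∷ xs) e = cong₂ _xor_ (e x) (xorSum-cong xs e)

xorSum-zero : {A : Set} (xs : List A) {f : A → Bool} →
  (∀ x → x ∈ xs → f x ≡ false) → xorSum xs f ≡ false
xorSum-zero []       e = refl
xorSum-zero (x ∷ xs) e =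
  cong₂ _xor_ (e x (here refl)) (xorSum-zero xs (λ y m → e y (there m)))

xorSum-xor : {A : Set} (xs : List A) (f g : A → Bool) →
  xorSum xs (λ x → f x xor g x) ≡ xorSum xs f xor xorSum xs g
xorSum-xor []       f g = refl
xorSum-xor (x ∷ xs) f g =
  trans (cong ((f x xor g x) xor_) (xorSum-xor xs f g))
        (xor-interchange (f x) (g x) (xorSum xs f) (xorSum xs g))

-- Check equations are used in this form: all terms but one are known to vanish, so the last one
-- does too. Uniqueness matters because a repeated entry would cancel itself.
xorSum-single : {A : Set} (xs : List A) {f : A → Bool} (a : A) → Unique xs → a ∈ xs →
  (∀ x → x ≢ a → f x ≡ false) → xorSum xs f ≡ f a
xorSum-single (x ∷ xs) {f} a (x∉ ∷ _) (here refl) e =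
  trans (cong (f x xor_) (xorSum-zero xs λ y m → e y (λ y≡x → All.lookup x∉ m (sym y≡x))))
        (Boolₚ.xor-identityʳ (f x))
xorSum-single (x ∷ xs) {f} a (x∉ ∷ u) (there m) e =
  trans (cong (_xor xorSum xs f) (e x (All.lookup x∉ m))) (xorSum-single xs a u m e)

xorSum-tabulate : {A B : Set} {n : ℕ} (f : Fin n → A) (f′ : Fin n → B)
  (g : A → Bool) (g′ : B → Bool) → (∀ i → g (f i) ≡ g′ (f′ i)) →
  xorSum (L.tabulate f) g ≡ xorSum (L.tabulate f′) g′
xorSum-tabulate {n = zero}  f f′ g g′ e = refl
xorSum-tabulate {n = suc n} f f′ g g′ e =
  cong₂ _xor_ (e zero) (xorSum-tabulate (f ∘ suc) (f′ ∘ suc) g g′ (e ∘ suc))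

kernel-linear : {X Y : Set} (xs : List X) (h : Y → X → Bool) →
  IsLinearCode (λ c → ∀ y → xorSum xs (λ x → h y x ∧ c x) ≡ false)
kernel-linear xs h =
    (λ y → xorSum-zero xs (λ x _ → Boolₚ.∧-zeroʳ (h y x)))
  , (λ c d Cc Cd y →
       trans (xorSum-cong xs (λ x → Boolₚ.∧-distribˡ-xor (h y x) (c x) (d x)))
      (trans (xorSum-xor xs (λ x → h y x ∧ c x) (λ x → h y x ∧ d x)) (cong₂ _xor_ (Cc y) (Cd y))))
  , (λ c d Cc e y →
       trans (xorSum-cong xs (λ x → cong (h y x ∧_) (sym (e x)))) (Cc y))

-- Dimension bounds from information sets

-- Words are functions, compared only pointwise, so the search runs over Boolean vectors and `P` has
-- to respect pointwise equality.
anyWord? : {X : Set} {N : ℕ} → X ↔ Fin N → {P : (X → Bool) → Set} →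
  (∀ {c d} → (∀ x → c x ≡ d x) → P c → P d) → (∀ c → Dec (P c)) → Dec (∃ P)
anyWord? X↔N {P} resp P? =
  map′ (λ (s , p) → _ , p)
       (λ (c , p) → tabulate (c ∘ from) ,
          resp (λ x → sym (trans (Vecₚ.lookup∘tabulate (c ∘ from) (to x))
                                 (cong c (strictlyInverseʳ x)))) p)
       (anySubset? (λ s → P? (lookup s ∘ to)))
  where open Inverse X↔N

-- Coordinates of J are removed one at a time: passing to the words that vanish at x
-- lowers the dimension by at most one.
infoSet⇒dimension : {X : Set} {N : ℕ} → X ↔ Fin N →
  (C : (X → Bool) → Set) → IsLinearCode C → (∀ c → Dec (C c)) → (J : List X) →
  (∀ c → C c → (∀ x → x ∈ J → c x ≡ false) → ∀ x → c x ≡ false) →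
  ∃[ k ] (HasDimension C k × k ≤ length J)
infoSet⇒dimension X↔N C lin C? [] info =
  0 , ((λ ()) , (λ ()) , (λ _ _ ()) ,
       λ c Cc → (λ ()) , info c Cc (λ _ ())) , z≤n
infoSet⇒dimension {X} X↔N C (C0 , C⊕ , C≗) C? (x ∷ J) info
  with infoSet⇒dimension X↔N C′ C′-linear (λ c → C? c ×-dec (c x Boolₚ.≟ false)) J info′
     | anyWord? X↔N {λ d → C d × d x ≡ true}
         (λ e (Cc , cx) → C≗ _ _ Cc e , trans (sym (e x)) cx)
         (λ d → C? d ×-dec (d x Boolₚ.≟ true))
  where
  C′ : (X → Bool) → Set
  C′ c = C c × c x ≡ false
  C′-linear : IsLinearCode C′
  C′-linear =
      (C0 , refl)
    , (λ c d (Cc , cx) (Cd , dx) → C⊕ c d Cc Cd , cong₂ _xor_ cx dx)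
    , (λ c d (Cc , cx) e → C≗ c d Cc e , trans (sym (e x)) cx)
  info′ : ∀ c → C′ c → (∀ y → y ∈ J → c y ≡ false) → ∀ y → c y ≡ false
  info′ c (Cc , cx) v = info c Cc λ { _ (here refl) → cx ; y (there m) → v y m }
... | k , (b , Cb , indep , span) , k≤ | no ¬d =
  k , (b , (λ i → proj₁ (Cb i)) , indep ,
       λ c Cc → span c (Cc , Boolₚ.¬-not (λ cx → ¬d (c , Cc , cx)))) ,
  ℕₚ.m≤n⇒m≤1+n k≤
... | k , (b , Cb , indep , span) , k≤ | yes (d , Cd , dx) =
  suc k , (b⁺ , Cb⁺ , indep⁺ , span⁺) , s≤s k≤
  where
  b⁺ : Fin (suc k) → X → Bool
  b⁺ zero    = d
  b⁺ (suc i) = b i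
  Cb⁺ : ∀ i → C (b⁺ i)
  Cb⁺ zero    = Cd
  Cb⁺ (suc i) = proj₁ (Cb i)
  expand : ∀ a y → lincomb a b⁺ y ≡ (a zero ∧ d y) xor lincomb (a ∘ suc) b y
  expand a y = cong ((a zero ∧ d y) xor_) (xorSum-tabulate (λ (i : Fin k) → Fin.suc i) id
    (λ i → a i ∧ b⁺ i y) (λ i → a (suc i) ∧ b i y) (λ i → refl))
  at-x : ∀ a → lincomb a b x ≡ false
  at-x a = xorSum-zero (allFin k)
    (λ i _ → trans (cong (a i ∧_) (proj₂ (Cb i))) (Boolₚ.∧-zeroʳ (a i)))
  indep⁺ : ∀ a → (∀ y → lincomb a b⁺ y ≡ false) → ∀ i → a i ≡ false
  indep⁺ a v = λ { zero → a₀ ; (suc i) → indep (a ∘ suc) rest i }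
    where
    a₀ : a zero ≡ false
    a₀ = begin
      a zero                                       ≡⟨ Boolₚ.∧-identityʳ (a zero) ⟨
      a zero ∧ true                                ≡⟨ cong (a zero ∧_) dx ⟨
      a zero ∧ d x                                 ≡⟨ Boolₚ.xor-identityʳ _ ⟨
      (a zero ∧ d x) xor false                     ≡⟨ cong ((a zero ∧ d x) xor_) (at-x (a ∘ suc)) ⟨
      (a zero ∧ d x) xor lincomb (a ∘ suc) b x     ≡⟨ expand a x ⟨
      lincomb a b⁺ x                               ≡⟨ v x ⟩
      false                                        ∎
      where open ≡-Reasoning
    rest : ∀ y → lincomb (a ∘ suc) b y ≡ false
    rest y = trans (cong (λ t → (t ∧ d y) xor lincomb (a ∘ suc) b y) (sym a₀))
                   (trans (sym (expand a y)) (v y))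
  span⁺ : ∀ c → C c → ∃[ a ] (∀ y → c y ≡ lincomb a b⁺ y)
  span⁺ c Cc with c x in cx
  ... | false with span c (Cc , cx)
  ...   | a , e = a′ , λ y → trans (e y) (sym (expand a′ y))
    where
    a′ : Fin (suc k) → Bool
    a′ zero    = false
    a′ (suc i) = a i
  -- Here `c ⊕ d` vanishes at `x` and is spanned by the basis of `C′`; adding `d` back recovers `c`.
  span⁺ c Cc | true with span (c ⊕ d) (C⊕ c d Cc Cd , cong₂ _xor_ cx dx)
  ...   | a , e = a′ , λ y → trans (c≡d⊕ y) (trans (cong (d y xor_) (e y)) (sym (expand a′ y)))
    where
    a′ : Fin (suc k) → Bool
    a′ zero    = true
    a′ (suc i) = a i
    c≡d⊕ : ∀ y → c y ≡ d y xor (c y xor d y)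
    c≡d⊕ y = begin
      c y                        ≡⟨ Boolₚ.xor-identityʳ (c y) ⟨
      c y xor false              ≡⟨ cong (c y xor_) (Boolₚ.xor-same (d y)) ⟨
      c y xor (d y xor d y)      ≡⟨ Boolₚ.xor-assoc (c y) (d y) (d y) ⟨
      (c y xor d y) xor d y      ≡⟨ Boolₚ.xor-comm (c y xor d y) (d y) ⟩
      d y xor (c y xor d y)      ∎
      where open ≡-Reasoning

-- Boolean tests and bijections with finite sets

does-true : {A : Set} (A? : Dec A) → does A? ≡ true → A
does-true (yes a) _ = a

and-map⁺ : {A : Set} (f : A → Bool) (xs : List A) → (∀ x → T (f x)) → T (and (L.map f xs))
and-map⁺ f []       t = tt
and-map⁺ f (x ∷ xs) t = Equivalence.from Boolₚ.T-∧ (t x , and-map⁺ f xs t)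

and-map⁻ : {A : Set} (f : A → Bool) {xs : List A} → T (and (L.map f xs)) → ∀ {x} → x ∈ xs → T (f x)
and-map⁻ f {x ∷ xs} t (here refl) = proj₁ (Equivalence.to (Boolₚ.T-∧ {f x}) t)
and-map⁻ f {x ∷ xs} t (there m)   = and-map⁻ f (proj₂ (Equivalence.to (Boolₚ.T-∧ {f x}) t)) m

vec-ext : {A : Set} {n : ℕ} {v w : Vec A n} → (∀ i → lookup v i ≡ lookup w i) → v ≡ w
vec-ext {v = v} {w} e =
  trans (sym (Vecₚ.tabulate∘lookup v)) (trans (Vecₚ.tabulate-cong e) (Vecₚ.tabulate∘lookup w))

Vec↔Fin^ : {q : ℕ} (n : ℕ) → Vec (Fin q) n ↔ Fin (q ^ n)
Vec↔Fin^ {q} n = mk↔ₛ′ (funToFin ∘ lookup) (λ k → tabulate (finToFun k))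
  (λ k → trans (funToFin-cong {n} (Vecₚ.lookup∘tabulate (finToFun k))) (Finₚ.funToFin-finToFin {n} {q} k))
  (λ v → trans (Vecₚ.tabulate-cong (Finₚ.finToFun-funToFin (lookup v))) (Vecₚ.tabulate∘lookup v))
  where
  funToFin-cong : ∀ {m} {f g : Fin m → Fin q} → (∀ i → f i ≡ g i) → funToFin f ≡ funToFin g
  funToFin-cong {zero}  e = refl
  funToFin-cong {suc m} e = cong₂ combine (e zero) (funToFin-cong (e ∘ suc))

≡⇒↔ : {m n : ℕ} → m ≡ n → Fin m ↔ Fin n
≡⇒↔ refl = ↔-refl

×-↔-Fin* : {A B : Set} {m n : ℕ} → A ↔ Fin m → B ↔ Fin n → (A × B) ↔ Fin (m * n)
×-↔-Fin* A↔ B↔ = ↔-trans (A↔ ×-↔ B↔) (↔-sym Finₚ.*↔×)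

-- The number n(n-1)/2 of entries above the diagonal; the recursion removes the first row and avoids
-- halving.
tri : ℕ → ℕ
tri zero    = 0
tri (suc n) = n + tri n

-- Field arithmetic and rank-one matrices

-- Writing the order as `suc q′` makes q - 1, the number of nonzero field elements, available
-- without truncated subtraction.
module Geometry {q′ : ℕ} (𝔽 : FieldOn (suc q′)) where
  open FieldOn 𝔽 renaming (_+_ to infixl 6 _+′_)
  open Matrices 𝔽

  q : ℕ
  q = suc q′

  F : Set
  F = Fin q

  R : CommutativeRing 0ℓ 0ℓ
  R = record { isCommutativeRing = isCommutativeRing }

  open CommutativeRing R using (+-assoc; +-comm; +-identityˡ; +-identityʳ; *-assoc; *-comm;
    *-identityˡ; *-identityʳ; zeroˡ; zeroʳ; -‿inverseʳ)
  open Algebra.Properties.Ring (CommutativeRing.ring R)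
    using (-‿distribˡ-*; -‿distribʳ-*; -‿involutive; x∙y⁻¹≈ε⇒x≈y; +-cancelˡ)
  open Solver (CommutativeRing.commutativeSemiring R) using (solve; _:=_; _:+_; _:*_)
  open ≡-Reasoning

  recip : ∀ x → x ≢ 0# → F
  recip x x≢0 = proj₁ (inverse x x≢0)

  recip-cancel : ∀ x (x≢0 : x ≢ 0#) y → recip x x≢0 · (x · y) ≡ y
  recip-cancel x x≢0 y = begin
    r · (x · y)  ≡⟨ solve 3 (λ r x y → r :* (x :* y) := (x :* r) :* y) refl r x y ⟩
    (x · r) · y  ≡⟨ cong (_· y) (proj₂ (inverse x x≢0)) ⟩
    1# · y       ≡⟨ *-identityˡ y ⟩
    y            ∎
    where r = recip x x≢0

  ·-cancelˡ : ∀ {x y z} → x ≢ 0# → x · y ≡ x · z → y ≡ z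
  ·-cancelˡ {x} {y} {z} x≢0 e =
    trans (sym (recip-cancel x x≢0 y)) (trans (cong (recip x x≢0 ·_) e) (recip-cancel x x≢0 z))

  ·-nonzero : ∀ {x y} → x ≢ 0# → y ≢ 0# → x · y ≢ 0#
  ·-nonzero x≢0 y≢0 e = y≢0 (·-cancelˡ x≢0 (trans e (sym (zeroʳ _))))

  +-cancel-neg : ∀ x y → (x +′ y) +′ (- y) ≡ x
  +-cancel-neg x y =
    trans (+-assoc x y (- y)) (trans (cong (x +′_) (-‿inverseʳ y)) (+-identityʳ x))

  -- The hypothesis says (x - y)² = 0.
  squares-equal : ∀ {x y} → x · x +′ y · y ≡ x · y +′ x · y → x ≡ y
  squares-equal {x} {y} e with (x +′ (- y)) Finₚ.≟ 0#
  ... | yes z = x∙y⁻¹≈ε⇒x≈y x y z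
  ... | no nz = ⊥-elim (·-nonzero nz nz (begin
    (x +′ (- y)) · (x +′ (- y))
      ≡⟨ solve 2 (λ x z → (x :+ z) :* (x :+ z) := (x :* x :+ z :* z) :+ (x :* z :+ x :* z)) refl x (- y) ⟩
    (x · x +′ (- y) · (- y)) +′ (x · (- y) +′ x · (- y))
      ≡⟨ cong₂ (λ s t → (x · x +′ s) +′ (t +′ t)) neg² (sym (-‿distribʳ-* x y)) ⟩
    (x · x +′ y · y) +′ (- (x · y) +′ - (x · y))
      ≡⟨ cong (_+′ (- (x · y) +′ - (x · y))) e ⟩
    (x · y +′ x · y) +′ (- (x · y) +′ - (x · y))
      ≡⟨ solve 2 (λ s t → (s :+ s) :+ (t :+ t) := (s :+ t) :+ (s :+ t)) refl (x · y) (- (x · y)) ⟩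
    (x · y +′ - (x · y)) +′ (x · y +′ - (x · y))
      ≡⟨ cong (λ s → s +′ s) (-‿inverseʳ (x · y)) ⟩
    0# +′ 0#
      ≡⟨ +-identityˡ 0# ⟩
    0# ∎))
    where
    neg² : (- y) · (- y) ≡ y · y
    neg² = trans (sym (-‿distribˡ-* y (- y)))
          (trans (cong -_ (sym (-‿distribʳ-* y y))) (-‿involutive (y · y)))

  -- The 2×2 minors of b w wᵀ - a v vᵀ on rows and columns i, k equal -ab (wᵢvₖ - wₖvᵢ)².
  rank-one-difference⇒parallel : {n : ℕ} (v w u t : Fin n → F) {a b : F} → a ≢ 0# → b ≢ 0# →
    (∀ i j → b · (w i · w j) ≡ a · (v i · v j) +′ u i · t j) →
    ∀ i k → w i · v k ≡ w k · v i
  rank-one-difference⇒parallel v w u t {a} {b} a≢0 b≢0 e i k =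
    squares-equal (·-cancelˡ (·-nonzero b≢0 a′≢0) (+-cancelˡ p _ _ minor))
    where
    a′ = - a
    a′≢0 : a′ ≢ 0#
    a′≢0 z = a≢0 (begin
      a          ≡⟨ +-identityʳ a ⟨
      a +′ 0#    ≡⟨ cong (a +′_) z ⟨
      a +′ - a   ≡⟨ -‿inverseʳ a ⟩
      0#         ∎)
    M : ∀ i j → b · (w i · w j) +′ a′ · (v i · v j) ≡ u i · t j
    M i j = begin
      b · (w i · w j) +′ a′ · (v i · v j)
        ≡⟨ cong (_+′ a′ · (v i · v j)) (e i j) ⟩
      (a · (v i · v j) +′ u i · t j) +′ a′ · (v i · v j)
        ≡⟨ solve 4 (λ a a′ s x → (a :* s :+ x) :+ a′ :* s := x :+ (a :+ a′) :* s) refl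
             a a′ (v i · v j) (u i · t j) ⟩
      u i · t j +′ (a +′ a′) · (v i · v j)
        ≡⟨ cong (λ z → u i · t j +′ z · (v i · v j)) (-‿inverseʳ a) ⟩
      u i · t j +′ 0# · (v i · v j)
        ≡⟨ cong (u i · t j +′_) (zeroˡ _) ⟩
      u i · t j +′ 0#
        ≡⟨ +-identityʳ _ ⟩
      u i · t j ∎
    x = w i · v k
    y = w k · v i
    -- The part common to both products of the minor. Cancelling it and the nonzero factor `b · a′`
    -- leaves x² + y² = 2xy; nothing is divided by 2, so characteristic 2 is no special case.
    p = (b · b) · ((w i · w i) · (w k · w k)) +′ (a′ · a′) · ((v i · v i) · (v k · v k))
    minor : p +′ (b · a′) · (x · x +′ y · y) ≡ p +′ (b · a′) · (x · y +′ x · y)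
    minor = begin
      p +′ (b · a′) · (x · x +′ y · y)
        ≡⟨ solve 6 (λ b a wi wk vi vk →
             ((b :* b) :* ((wi :* wi) :* (wk :* wk)) :+ (a :* a) :* ((vi :* vi) :* (vk :* vk)))
               :+ (b :* a) :* ((wi :* vk) :* (wi :* vk) :+ (wk :* vi) :* (wk :* vi))
             := (b :* (wi :* wi) :+ a :* (vi :* vi)) :* (b :* (wk :* wk) :+ a :* (vk :* vk)))
             refl b a′ (w i) (w k) (v i) (v k) ⟩
      (b · (w i · w i) +′ a′ · (v i · v i)) · (b · (w k · w k) +′ a′ · (v k · v k))
        ≡⟨ cong₂ _·_ (M i i) (M k k) ⟩
      (u i · t i) · (u k · t k)
        ≡⟨ solve 4 (λ a b c d → (a :* b) :* (c :* d) := (a :* d) :* (c :* b)) refl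
             (u i) (t i) (u k) (t k) ⟩
      (u i · t k) · (u k · t i)
        ≡⟨ cong₂ _·_ (M i k) (M k i) ⟨
      (b · (w i · w k) +′ a′ · (v i · v k)) · (b · (w k · w i) +′ a′ · (v k · v i))
        ≡⟨ solve 6 (λ b a wi wk vi vk →
             (b :* (wi :* wk) :+ a :* (vi :* vk)) :* (b :* (wk :* wi) :+ a :* (vk :* vi))
             := ((b :* b) :* ((wi :* wi) :* (wk :* wk)) :+ (a :* a) :* ((vi :* vi) :* (vk :* vk)))
               :+ (b :* a) :* ((wi :* vk) :* (wk :* vi) :+ (wi :* vk) :* (wk :* vi)))
             refl b a′ (w i) (w k) (v i) (v k) ⟩
      p +′ (b · a′) · (x · y +′ x · y) ∎

  -- Coordinates on symmetric matrices

  ent : ∀ {n} → Point n → Fin n → Fin n → F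
  ent (M , _) = entry M

  ent-sym : ∀ {n} (S : Point n) i j → ent S i j ≡ ent S j i
  ent-sym {n} (M , s) i j =
    does-true (entry M i j Finₚ.≟ entry M j i)
      (Equivalence.to Boolₚ.T-≡ (and-map⁻ _ (and-map⁻ _ s (∈ₚ.∈-allFin i)) (∈ₚ.∈-allFin j)))

  mat-ext : ∀ {m k} {A B : Mat m k} → (∀ i j → entry A i j ≡ entry B i j) → A ≡ B
  mat-ext e = vec-ext (λ i → vec-ext (e i))

  point-ext : ∀ {n} {S S′ : Point n} → (∀ i j → ent S i j ≡ ent S′ i j) → S ≡ S′
  point-ext {S = M , s} {M′ , s′} e with mat-ext {A = M} {M′} e
  ... | refl = cong (M ,_) (Boolₚ.T-irrelevant s s′)

  matrix : ∀ {m k} → (Fin m → Fin k → F) → Mat m k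
  matrix f = tabulate (λ i → tabulate (f i))

  entry-matrix : ∀ {m k} (f : Fin m → Fin k → F) i j → entry (matrix f) i j ≡ f i j
  entry-matrix f i j =
    trans (cong (λ v → lookup v j) (Vecₚ.lookup∘tabulate _ i)) (Vecₚ.lookup∘tabulate (f i) j)

  abstract
    -- Kept opaque so that a point is handled through its entries, without unfolding its matrix and
    -- symmetry test.
    symPoint : ∀ {n} (f : Fin n → Fin n → F) → (∀ i j → f i j ≡ f j i) → Point n
    symPoint {n} f s = matrix f ,
      and-map⁺ _ (allFin n) (λ i → and-map⁺ _ (allFin n) (λ j → Equivalence.from Boolₚ.T-≡ (dec-true (_ Finₚ.≟ _)
        (trans (entry-matrix f i j) (trans (s i j) (sym (entry-matrix f j i)))))))

    ent-symPoint : ∀ {n} f (s : ∀ i j → f i j ≡ f j i) i j → ent {n} (symPoint f s) i j ≡ f i j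
    ent-symPoint f s = entry-matrix f

  -- The entries above the diagonal, row by row. Splitting them from the diagonal turns the sets to
  -- be counted into products, since the conditions imposed later concern the diagonal alone.
  Off : ℕ → Set
  Off zero    = ⊤
  Off (suc n) = Vec F n × Off n

  Off↔ : ∀ n → Off n ↔ Fin (q ^ tri n)
  Off↔ zero    = ↔-sym Finₚ.1↔⊤
  Off↔ (suc n) = ↔-trans (×-↔-Fin* (Vec↔Fin^ n) (Off↔ n))
                         (≡⇒↔ (sym (ℕₚ.^-distribˡ-+-* q n (tri n))))

  symEntry : ∀ {n} → Vec F n → Off n → Fin n → Fin n → F
  symEntry (a ∷ d) (r , o) zero    zero    = a
  symEntry (a ∷ d) (r , o) zero    (suc j) = lookup r j
  symEntry (a ∷ d) (r , o) (suc i) zero    = lookup r i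
  symEntry (a ∷ d) (r , o) (suc i) (suc j) = symEntry d o i j

  symEntry-sym : ∀ {n} (d : Vec F n) o i j → symEntry d o i j ≡ symEntry d o j i
  symEntry-sym (a ∷ d) (r , o) zero    zero    = refl
  symEntry-sym (a ∷ d) (r , o) zero    (suc j) = refl
  symEntry-sym (a ∷ d) (r , o) (suc i) zero    = refl
  symEntry-sym (a ∷ d) (r , o) (suc i) (suc j) = symEntry-sym d o i j

  symEntry-diag : ∀ {n} (d : Vec F n) o i → symEntry d o i i ≡ lookup d i
  symEntry-diag (a ∷ d) (r , o) zero    = refl
  symEntry-diag (a ∷ d) (r , o) (suc i) = symEntry-diag d o i

  offOf : ∀ {n} → (Fin n → Fin n → F) → Off n
  offOf {zero}  f = tt
  offOf {suc n} f = tabulate (λ j → f zero (suc j)) , offOf (λ i j → f (suc i) (suc j))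

  offOf-cong : ∀ {n} {f g : Fin n → Fin n → F} → (∀ i j → f i j ≡ g i j) → offOf f ≡ offOf g
  offOf-cong {zero}  e = refl
  offOf-cong {suc n} e =
    cong₂ _,_ (Vecₚ.tabulate-cong (λ j → e zero (suc j))) (offOf-cong (λ i j → e (suc i) (suc j)))

  offOf-symEntry : ∀ {n} (d : Vec F n) o → offOf (symEntry d o) ≡ o
  offOf-symEntry []      tt      = refl
  offOf-symEntry (a ∷ d) (r , o) = cong₂ _,_ (Vecₚ.tabulate∘lookup r) (offOf-symEntry d o)

  symEntry-offOf : ∀ {n} (f : Fin n → Fin n → F) → (∀ i j → f i j ≡ f j i) →
    ∀ i j → symEntry (tabulate (λ i → f i i)) (offOf f) i j ≡ f i j
  symEntry-offOf f s zero    zero    = refl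
  symEntry-offOf f s zero    (suc j) = Vecₚ.lookup∘tabulate _ j
  symEntry-offOf f s (suc i) zero    = trans (Vecₚ.lookup∘tabulate _ i) (s zero (suc i))
  symEntry-offOf f s (suc i) (suc j) = symEntry-offOf _ (λ i j → s (suc i) (suc j)) i j

  build : ∀ {n} → Vec F n → Off n → Point n
  build d o = symPoint (symEntry d o) (symEntry-sym d o)

  diag : ∀ {n} → Point n → Vec F n
  diag S = tabulate (λ i → ent S i i)

  off : ∀ {n} → Point n → Off n
  off S = offOf (ent S)

  ent-build : ∀ {n} (d : Vec F n) o i j → ent (build d o) i j ≡ symEntry d o i j
  ent-build d o = ent-symPoint (symEntry d o) (symEntry-sym d o)

  ent-build-diag : ∀ {n} (d : Vec F n) o i → ent (build d o) i i ≡ lookup d i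
  ent-build-diag d o i = trans (ent-build d o i i) (symEntry-diag d o i)

  diag-build : ∀ {n} (d : Vec F n) o → diag (build d o) ≡ d
  diag-build d o =
    trans (Vecₚ.tabulate-cong (ent-build-diag d o)) (Vecₚ.tabulate∘lookup d)

  off-build : ∀ {n} (d : Vec F n) o → off (build d o) ≡ o
  off-build d o = trans (offOf-cong (ent-build d o)) (offOf-symEntry d o)

  build-diag-off : ∀ {n} (S : Point n) → build (diag S) (off S) ≡ S
  build-diag-off S = point-ext (λ i j →
    trans (ent-build (diag S) (off S) i j) (symEntry-offOf (ent S) (ent-sym S) i j))

  Point↔ : ∀ n → Point n ↔ Fin (q ^ (n + tri n))
  Point↔ n = ↔-trans
    (mk↔ₛ′ (λ S → diag S , off S) (λ (d , o) → build d o)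
      (λ (d , o) → cong₂ _,_ (diag-build d o) (off-build d o)) build-diag-off)
    (↔-trans (×-↔-Fin* (Vec↔Fin^ n) (Off↔ n)) (≡⇒↔ (sym (ℕₚ.^-distribˡ-+-* q n (tri n)))))

  -- Directions: nonzero vectors whose first nonzero coordinate is 1, one for each
  -- one-dimensional subspace.
  Dir : ℕ → Set
  Dir zero    = ⊥
  Dir (suc n) = Vec F n ⊎ Dir n

  #Dir : ℕ → ℕ
  #Dir zero    = 0
  #Dir (suc n) = q ^ n + #Dir n

  Dir↔ : ∀ n → Dir n ↔ Fin (#Dir n)
  Dir↔ zero    = ↔-sym Finₚ.0↔⊥
  Dir↔ (suc n) = ↔-trans (Vec↔Fin^ n ⊎-↔ Dir↔ n) (↔-sym Finₚ.+↔⊎)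

  -- Sorting directions by the position of the leading 1 gives q^(n-1) + ... + q + 1, and
  -- multiplying by q - 1 telescopes.
  #Dir-formula : ∀ n → suc (#Dir n * q′) ≡ q ^ n
  #Dir-formula zero    = refl
  #Dir-formula (suc n) = begin
      suc ((q ^ n + #Dir n) * q′)           ≡⟨ cong suc (ℕₚ.*-distribʳ-+ q′ (q ^ n) (#Dir n)) ⟩
      suc (q ^ n * q′ + #Dir n * q′)        ≡⟨ ℕₚ.+-suc (q ^ n * q′) (#Dir n * q′) ⟨
      q ^ n * q′ + suc (#Dir n * q′)        ≡⟨ cong (q ^ n * q′ +_) (#Dir-formula n) ⟩
      q ^ n * q′ + q ^ n                    ≡⟨ ℕₚ.+-comm (q ^ n * q′) (q ^ n) ⟩
      q ^ n + q ^ n * q′                    ≡⟨ cong (q ^ n +_) (ℕₚ.*-comm (q ^ n) q′) ⟩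
      q ^ n + q′ * q ^ n                    ∎

  vec : ∀ {n} → Dir n → Fin n → F
  vec {suc n} (inj₁ r) zero    = 1#
  vec {suc n} (inj₁ r) (suc i) = lookup r i
  vec {suc n} (inj₂ v) zero    = 0#
  vec {suc n} (inj₂ v) (suc i) = vec v i

  -- The position of the leading 1. There v vᵀ has diagonal entry 1, so this diagonal entry serves
  -- as the coordinate along any line in direction v.
  pivot : ∀ {n} → Dir n → Fin n
  pivot {suc n} (inj₁ r) = zero
  pivot {suc n} (inj₂ v) = suc (pivot v)

  vec-pivot : ∀ {n} (v : Dir n) → vec v (pivot v) ≡ 1#
  vec-pivot {suc n} (inj₁ r) = refl
  vec-pivot {suc n} (inj₂ v) = vec-pivot v

  axis : ∀ {n} → Fin n → Dir n
  axis {suc n} zero    = inj₁ (V.replicate n 0#)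
  axis {suc n} (suc i) = inj₂ (axis i)

  vec-axis-≡ : ∀ {n} (i : Fin n) → vec (axis i) i ≡ 1#
  vec-axis-≡ zero    = refl
  vec-axis-≡ (suc i) = vec-axis-≡ i

  vec-axis-≢ : ∀ {n} (i j : Fin n) → j ≢ i → vec (axis i) j ≡ 0#
  vec-axis-≢ zero    zero    j≢i = ⊥-elim (j≢i refl)
  vec-axis-≢ zero    (suc j) j≢i = Vecₚ.lookup-replicate j 0#
  vec-axis-≢ (suc i) zero    j≢i = refl
  vec-axis-≢ (suc i) (suc j) j≢i = vec-axis-≢ i j (j≢i ∘ cong suc)

  -- Coordinate 0 and the pivot of `inj₂ v` already give a contradiction: one product is 1 · 1, the
  -- other contains the leading 0.
  first-coordinates-differ : ∀ {n} (r : Vec F n) (v : Dir n) →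
    ¬ (∀ i k → vec {suc n} (inj₁ r) i · vec {suc n} (inj₂ v) k
             ≡ vec {suc n} (inj₁ r) k · vec {suc n} (inj₂ v) i)
  first-coordinates-differ r v e = 0≢1 (begin
    0#                              ≡⟨ zeroʳ _ ⟨
    lookup r (pivot v) · 0#         ≡⟨ e zero (suc (pivot v)) ⟨
    1# · vec v (pivot v)            ≡⟨ *-identityˡ _ ⟩
    vec v (pivot v)                 ≡⟨ vec-pivot v ⟩
    1#                              ∎)

  -- At a common leading position both vectors have entry 1, so the factor of proportionality is 1.
  parallel⇒≡ : ∀ {n} (w v : Dir n) → (∀ i k → vec w i · vec v k ≡ vec w k · vec v i) → w ≡ v
  parallel⇒≡ {suc n} (inj₁ s) (inj₁ r) e = cong inj₁ (vec-ext λ i →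
    trans (sym (*-identityʳ _)) (trans (e (suc i) zero) (*-identityˡ _)))
  parallel⇒≡ {suc n} (inj₁ s) (inj₂ v) e = ⊥-elim (first-coordinates-differ s v e)
  parallel⇒≡ {suc n} (inj₂ w) (inj₁ r) e = ⊥-elim (first-coordinates-differ r w
    (λ i k → trans (*-comm _ _) (trans (e k i) (*-comm _ _))))
  parallel⇒≡ {suc n} (inj₂ w) (inj₂ v) e = cong inj₂ (parallel⇒≡ w v (λ i k → e (suc i) (suc k)))

  normalise : ∀ {n} (u : Fin n → F) → (∀ i → u i ≡ 0#) ⊎
    (∃[ v ] ∃[ a ] (a ≢ 0# × ∀ i → u i ≡ a · vec v i))
  normalise {zero}  u = inj₁ λ ()
  normalise {suc n} u with u zero Finₚ.≟ 0#
  ... | no u₀≢0 = inj₂ (inj₁ (tabulate (λ i → recip (u zero) u₀≢0 · u (suc i))) , u zero , u₀≢0 ,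
        λ { zero    → sym (*-identityʳ _)
          ; (suc i) → sym (trans (cong (u zero ·_) (Vecₚ.lookup∘tabulate _ i)) (begin
              u zero · (recip (u zero) u₀≢0 · u (suc i))
                ≡⟨ solve 3 (λ x r y → x :* (r :* y) := r :* (x :* y)) refl _ _ _ ⟩
              recip (u zero) u₀≢0 · (u zero · u (suc i))
                ≡⟨ recip-cancel (u zero) u₀≢0 (u (suc i)) ⟩
              u (suc i) ∎)) })
  ... | yes u₀≡0 with normalise (u ∘ suc)
  ...   | inj₁ z = inj₁ λ { zero → u₀≡0 ; (suc i) → z i }
  ...   | inj₂ (v , a , a≢0 , e) = inj₂ (inj₂ v , a , a≢0 ,
          λ { zero → trans u₀≡0 (sym (zeroʳ a)) ; (suc i) → e i })

  -- Rank-one steps and adjacency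

  infix 4 _≐_+_⟨_⟩²
  -- The relation T′ = S + x v vᵀ, kept entrywise. Being a record, it lets the points, `x` and `v`
  -- be inferred from a proof.
  record _≐_+_⟨_⟩² {n} (T′ S : Point n) (x : F) (v : Dir n) : Set where
    constructor mk≐
    field
      at : ∀ i j → ent T′ i j ≡ ent S i j +′ x · (vec v i · vec v j)
  open _≐_+_⟨_⟩²

  abstract
    move-sym : ∀ {n} (v : Dir n) x (S : Point n) i j →
      ent S i j +′ x · (vec v i · vec v j) ≡ ent S j i +′ x · (vec v j · vec v i)
    move-sym v x S i j = cong₂ (λ s t → s +′ x · t) (ent-sym S i j) (*-comm _ _)

    move : ∀ {n} (v : Dir n) → F → Point n → Point n
    move v x S = symPoint _ (move-sym v x S)

    move-≐ : ∀ {n} (v : Dir n) x (S : Point n) → move v x S ≐ S + x ⟨ v ⟩²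
    move-≐ v x S = mk≐ (ent-symPoint _ (move-sym v x S))

  ≐-inverse : ∀ {n} {v : Dir n} {x : F} {S T′ : Point n} → T′ ≐ S + x ⟨ v ⟩² → S ≐ T′ + - x ⟨ v ⟩²
  ≐-inverse {v = v} {x} {S} {T′} e = mk≐ λ i j → let y = vec v i · vec v j in sym (begin
    ent T′ i j +′ (- x) · y                ≡⟨ cong₂ _+′_ (at e i j) (sym (-‿distribˡ-* x y)) ⟩
    (ent S i j +′ x · y) +′ - (x · y)      ≡⟨ +-cancel-neg _ _ ⟩
    ent S i j                              ∎)

  ≐-trans : ∀ {n} {v : Dir n} {x y} {S T′ U : Point n} →
    T′ ≐ S + x ⟨ v ⟩² → U ≐ T′ + y ⟨ v ⟩² → U ≐ S + (x +′ y) ⟨ v ⟩²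
  ≐-trans {v = v} {x} {y} {S} {T′} e f = mk≐ λ i j →
    trans (at f i j) (trans (cong (_+′ y · (vec v i · vec v j)) (at e i j))
      (solve 4 (λ s x y z → (s :+ x :* z) :+ y :* z := s :+ (x :+ y) :* z) refl
        (ent S i j) x y (vec v i · vec v j)))

  ≐-zero : ∀ {n} {v : Dir n} {x} {S T′ : Point n} → x ≡ 0# → T′ ≐ S + x ⟨ v ⟩² → T′ ≡ S
  ≐-zero {S = S} refl e = point-ext (λ i j →
    trans (at e i j) (trans (cong (ent S i j +′_) (zeroˡ _)) (+-identityʳ _)))

  ≐-pivot : ∀ {n} {v : Dir n} {x} {S T′ : Point n} → T′ ≐ S + x ⟨ v ⟩² →
    ent T′ (pivot v) (pivot v) ≡ ent S (pivot v) (pivot v) +′ x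
  ≐-pivot {v = v} {x} {S} e = trans (at e p p) (cong (ent S p p +′_)
      (trans (cong (x ·_) (trans (cong₂ _·_ (vec-pivot v) (vec-pivot v)) (*-identityʳ 1#)))
             (*-identityʳ x)))
    where p = pivot v

  entry-⊖ : ∀ {n} (S S′ : Point n) i j → entry (proj₁ S ⊖ proj₁ S′) i j ≡ ent S i j +′ - ent S′ i j
  entry-⊖ (A , _) (B , _) i j =
    trans (cong (λ v → lookup v j) (Vecₚ.lookup-zipWith (V.zipWith _-ᶠ_) i A B))
          (Vecₚ.lookup-zipWith _-ᶠ_ j (lookup A i) (lookup B i))
    where
    _-ᶠ_ : F → F → F
    x -ᶠ y = x +′ - y

  adjacent⇒≢ : ∀ {n} (S S′ : Point n) → Adjacent S S′ → S ≢ S′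
  adjacent⇒≢ S _ (_ , ¬0) refl = ¬0 0 (s≤s z≤n)
    -- The zero matrix factors through dimension 0, as a product of empty matrices.
    (matrix (λ i ()) , [] , mat-ext (λ i j →
      trans (entry-⊖ S S i j) (trans (-‿inverseʳ _) (sym (entry-matrix _ i j)))))

  adjacent⇒outer : ∀ {n : ℕ} (S S′ : Point n) → Adjacent S S′ →
    Σ[ u ∈ (Fin n → F) ] Σ[ t ∈ (Fin n → F) ] (∀ i j → ent S i j ≡ ent S′ i j +′ u i · t j)
  adjacent⇒outer S S′ ((A , B , e) , _) =
    (λ i → entry A i zero) , (λ j → entry B zero j) , λ i j → begin
      ent S i j
        ≡⟨ +-cancel-neg _ _ ⟨
      (ent S i j +′ ent S′ i j) +′ - ent S′ i j
        ≡⟨ solve 3 (λ a b c → (a :+ b) :+ c := b :+ (a :+ c)) refl (ent S i j) (ent S′ i j) (- ent S′ i j) ⟩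
      ent S′ i j +′ (ent S i j +′ - ent S′ i j)
        ≡⟨ cong (ent S′ i j +′_) (trans (sym (entry-⊖ S S′ i j))
             (trans (cong (λ M → entry M i j) e) (trans (entry-matrix _ i j) (+-identityʳ _)))) ⟩
      ent S′ i j +′ entry A i zero · entry B zero j ∎

  outer⇒adjacent : ∀ {n} (S S′ : Point n) (u t : Fin n → F) →
    (∀ i j → ent S i j ≡ ent S′ i j +′ u i · t j) → S ≢ S′ → Adjacent S S′
  outer⇒adjacent {n} S S′ u t e S≢S′ =
    (A , B , mat-ext (λ i j → trans (entry-⊖ S S′ i j) (trans (begin
      ent S i j +′ - ent S′ i j
        ≡⟨ cong (_+′ - ent S′ i j) (trans (e i j) (+-comm _ _)) ⟩
      (u i · t j +′ ent S′ i j) +′ - ent S′ i j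
        ≡⟨ +-cancel-neg _ _ ⟩
      u i · t j
        ≡⟨ cong₂ _·_ (entry-matrix (λ i _ → u i) i zero) (entry-matrix {1} (λ _ j → t j) zero j) ⟨
      entry A i zero · entry B zero j
        ≡⟨ +-identityʳ _ ⟨
      entry A i zero · entry B zero j +′ 0# ∎) (sym (entry-matrix _ i j))))) ,
    -- A factorisation through dimension 0 has only empty sums as entries, so the two points would
    -- coincide.
    λ { zero _ (C , D , z) → S≢S′ (point-ext λ i j → x∙y⁻¹≈ε⇒x≈y _ _
          (trans (sym (entry-⊖ S S′ i j)) (trans (cong (λ M → entry M i j) z) (entry-matrix _ i j))))
      ; (suc _) (s≤s ()) _ }
    where
    A : Mat n 1
    A = matrix (λ i _ → u i)
    B : Mat 1 n
    B = matrix (λ _ j → t j)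

  -- Write the difference as u tᵀ with u = a v. Symmetry, read in the row of the pivot p of v, gives
  -- t = t_p v, so the difference is (a t_p) v vᵀ.
  adjacent⇒≐ : ∀ {n} (S S′ : Point n) → Adjacent S S′ →
    ∃[ v ] ∃[ x ] (x ≢ 0# × S ≐ S′ + x ⟨ v ⟩²)
  adjacent⇒≐ S S′ adj with adjacent⇒outer S S′ adj
  ... | u , t , e with normalise u
  ...   | inj₁ z = ⊥-elim (adjacent⇒≢ S S′ adj (point-ext λ i j →
            trans (e i j) (trans (cong (ent S′ i j +′_) (trans (cong (_· t j) (z i)) (zeroˡ _)))
              (+-identityʳ _))))
  ...   | inj₂ (v , a , a≢0 , u≡av) = v , a · t p , x≢0 , step
    where
    p = pivot v
    ut-sym : ∀ i j → u i · t j ≡ u j · t i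
    ut-sym i j = +-cancelˡ (ent S′ i j) _ _ (trans (sym (e i j))
      (trans (ent-sym S i j) (trans (e j i) (cong (_+′ u j · t i) (ent-sym S′ j i)))))
    t≡ : ∀ j → t j ≡ t p · vec v j
    t≡ j = ·-cancelˡ a≢0 (begin
      a · t j                ≡⟨ cong (_· t j) (trans (cong (a ·_) (vec-pivot v)) (*-identityʳ a)) ⟨
      (a · vec v p) · t j    ≡⟨ cong (_· t j) (u≡av p) ⟨
      u p · t j              ≡⟨ ut-sym p j ⟩
      u j · t p              ≡⟨ cong (_· t p) (u≡av j) ⟩
      (a · vec v j) · t p    ≡⟨ solve 3 (λ a b c → (a :* b) :* c := a :* (c :* b)) refl _ _ _ ⟩
      a · (t p · vec v j)    ∎)
    step : S ≐ S′ + a · t p ⟨ v ⟩²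
    step = mk≐ λ i j → trans (e i j) (cong (ent S′ i j +′_) (begin
      u i · t j                          ≡⟨ cong₂ _·_ (u≡av i) (t≡ j) ⟩
      (a · vec v i) · (t p · vec v j)
        ≡⟨ solve 4 (λ a b c d → (a :* b) :* (c :* d) := (a :* c) :* (b :* d)) refl _ _ _ _ ⟩
      (a · t p) · (vec v i · vec v j)    ∎))
    x≢0 : a · t p ≢ 0#
    x≢0 z = adjacent⇒≢ S S′ adj (≐-zero z step)

  ≐⇒adjacent : ∀ {n} {v : Dir n} {x} {S T′ : Point n} → T′ ≐ S + x ⟨ v ⟩² → T′ ≢ S → Adjacent T′ S
  ≐⇒adjacent {v = v} {x} {S} {T′} e = outer⇒adjacent T′ S (λ i → x · vec v i) (vec v)
    (λ i j → trans (at e i j) (cong (ent S i j +′_) (sym (*-assoc _ _ _))))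

  -- Subtracting S leaves b w wᵀ = a v vᵀ + u tᵀ, and vanishing minors make v and w parallel. The
  -- term u tᵀ may be zero, which is the case that `on-injective` uses.
  triangle-direction : ∀ {n} {v w : Dir n} {a b} {S S′ T′ : Point n} (u t : Fin n → F) →
    a ≢ 0# → b ≢ 0# → S′ ≐ S + a ⟨ v ⟩² → T′ ≐ S + b ⟨ w ⟩² →
    (∀ i j → ent T′ i j ≡ ent S′ i j +′ u i · t j) → w ≡ v
  triangle-direction {v = v} {w} {a} {b} {S} {S′} {T′} u t a≢0 b≢0 e f g =
    parallel⇒≡ w v (rank-one-difference⇒parallel (vec v) (vec w) u t a≢0 b≢0 λ i j →
      +-cancelˡ (ent S i j) _ _ (begin
        ent S i j +′ b · (vec w i · vec w j)                    ≡⟨ at f i j ⟨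
        ent T′ i j                                              ≡⟨ g i j ⟩
        ent S′ i j +′ u i · t j                                 ≡⟨ cong (_+′ u i · t j) (at e i j) ⟩
        (ent S i j +′ a · (vec v i · vec v j)) +′ u i · t j     ≡⟨ +-assoc _ _ _ ⟩
        ent S i j +′ (a · (vec v i · vec v j) +′ u i · t j)     ∎))

injective⇒size≤ : {A B : Set} {m n : ℕ} → A ↔ Fin m → B ↔ Fin n → (f : A → B) →
  (∀ {x y} → f x ≡ f y → x ≡ y) → m ≤ n
injective⇒size≤ A↔ B↔ f inj = Finₚ.injective⇒≤ {f = B.to ∘ f ∘ A.from}
  (A.from-injective ∘ inj ∘ B.to-injective)
  where
  module A where
    open Inverse A↔ public
    from-injective : ∀ {i j} → from i ≡ from j → i ≡ j
    from-injective {i} {j} e =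
      trans (sym (strictlyInverseˡ i)) (trans (cong to e) (strictlyInverseˡ j))
  module B where
    open Inverse B↔ public
    to-injective : ∀ {x y} → to x ≡ to y → x ≡ y
    to-injective {x} {y} e =
      trans (sym (strictlyInverseʳ x)) (trans (cong from e) (strictlyInverseʳ y))

-- Parametrisation and classification of the lines

module Lines {q′ : ℕ} (𝔽 : FieldOn (suc q′)) where
  open FieldOn 𝔽 renaming (_+_ to infixl 6 _+′_)
  open Matrices 𝔽
  open Geometry 𝔽
  open _≐_+_⟨_⟩²
  open Algebra.Properties.Ring (CommutativeRing.ring R) using (+-cancelˡ)
  open CommutativeRing R using (+-identityˡ; +-identityʳ; -‿inverseʳ; zeroˡ)

  insertZero : ∀ {n} → Vec F (pred n) → Fin n → Vec F n
  insertZero {suc n} d i = insertAt d i 0#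

  remove : ∀ {n} → Vec F n → Fin n → Vec F (pred n)
  remove {suc n} = removeAt

  lookup-insertZero : ∀ {n} (d : Vec F (pred n)) (i : Fin n) → lookup (insertZero d i) i ≡ 0#
  lookup-insertZero {suc n} d i = Vecₚ.insertAt-lookup d i 0#

  remove-insertZero : ∀ {n} (d : Vec F (pred n)) (i : Fin n) → remove (insertZero d i) i ≡ d
  remove-insertZero {suc n} d i = Vecₚ.removeAt-insertAt d i 0#

  insertZero-remove : ∀ {n} (d : Vec F n) (i : Fin n) → lookup d i ≡ 0# → insertZero (remove d i) i ≡ d
  insertZero-remove {suc n} d i z =
    trans (cong (insertAt (removeAt d i) i) (sym z)) (Vecₚ.insertAt-removeAt d i)

  LineCode : ℕ → Set
  LineCode n = Dir n × (Vec F (pred n) × Off n)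

  -- With `#Dir n` equal to (qⁿ - 1)/(q - 1) and (n-1) + n(n-1)/2 = (n² + n - 2)/2, this is the
  -- length claimed for Cᵀ when n is positive.
  #Line : ℕ → ℕ
  #Line n = #Dir n * (q ^ pred n * q ^ tri n)

  LineCode↔ : ∀ n → LineCode n ↔ Fin (#Line n)
  LineCode↔ n = ×-↔-Fin* (Dir↔ n) (×-↔-Fin* (Vec↔Fin^ (pred n)) (Off↔ n))

  module _ {n : ℕ} where

    dir : LineCode n → Dir n
    dir = proj₁

    -- Each line in direction v has exactly one point whose diagonal entry at the pivot of v is 0.
    base : LineCode n → Point n
    base (v , d , o) = build (insertZero d (pivot v)) o

    base-pivot : ∀ L → ent (base L) (pivot (dir L)) (pivot (dir L)) ≡ 0#
    base-pivot (v , d , o) =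
      trans (ent-build-diag (insertZero d (pivot v)) o (pivot v)) (lookup-insertZero d (pivot v))

    On : LineCode n → Point n → Set
    On L S = ∃[ x ] (S ≐ base L + x ⟨ dir L ⟩²)

    On? : ∀ L S → Dec (On L S)
    On? L S = Finₚ.any? (λ x → map′ mk≐ at (Finₚ.all? λ i → Finₚ.all? λ j → _ Finₚ.≟ _))

    abstract
      on : LineCode n → Point n → Bool
      on L S = does (On? L S)

      on⁺ : ∀ L S → On L S → on L S ≡ true
      on⁺ L S = dec-true (On? L S)

      on⁻ : ∀ L S → on L S ≡ true → On L S
      on⁻ L S = does-true (On? L S)

    -- A step x along v adds x at the pivot, so stepping by minus the pivot entry reaches the base
    -- point of the line through S.
    normalPoint : Dir n → Point n → Point n
    normalPoint v S = move v (- ent S (pivot v) (pivot v)) S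

    code : Dir n → Point n → LineCode n
    code v B = v , remove (diag B) (pivot v) , off B

    lineThrough : Dir n → Point n → LineCode n
    lineThrough v S = code v (normalPoint v S)

    base-lineThrough : ∀ (v : Dir n) (S : Point n) → base (lineThrough v S) ≡ normalPoint v S
    base-lineThrough v S = trans
      (cong (λ d → build d (off B))
        (insertZero-remove (diag B) p pp))
      (build-diag-off B)
      where
      p = pivot v
      B = normalPoint v S
      pp : lookup (diag B) p ≡ 0#
      pp = trans (Vecₚ.lookup∘tabulate (λ i → ent B i i) p)
        (trans (≐-pivot (move-≐ v (- ent S p p) S)) (-‿inverseʳ (ent S p p)))

    -- If S is at offset x from the base, its pivot entry is x, and normalising moves it by -x, back
    -- to the base. So any point of a line, with the direction, determines its code.
    lineThrough-base : ∀ L {S} → On L S → lineThrough (dir L) S ≡ L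
    lineThrough-base L@(v , d , o) {S} (x , e) = trans (cong (code v) B≡) (cong (v ,_) (cong₂ _,_
      (trans (cong (λ d → remove d p) (diag-build (insertZero d p) o)) (remove-insertZero d p))
      (off-build (insertZero d p) o)))
      where
      p = pivot v
      B≡ : normalPoint v S ≡ base L
      B≡ = ≐-zero
        (trans (cong (λ z → x +′ - z) (trans (≐-pivot e)
          (trans (cong (_+′ x) (base-pivot L)) (+-identityˡ x)))) (-‿inverseʳ x))
        (≐-trans e (move-≐ v (- ent S p p) S))

    on-lineThrough⁻ : ∀ {v : Dir n} {S T′ : Point n} → On (lineThrough v S) T′ → ∃[ x ] (T′ ≐ S + x ⟨ v ⟩²)
    on-lineThrough⁻ {v} {S} {T′} (x , e) =
      _ , ≐-trans (move-≐ v (- ent S (pivot v) (pivot v)) S) (subst (λ B → T′ ≐ B + x ⟨ v ⟩²) (base-lineThrough v S) e)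

    on-lineThrough⁺ : ∀ {v : Dir n} {S T′ : Point n} {x : F} → T′ ≐ S + x ⟨ v ⟩² → On (lineThrough v S) T′
    on-lineThrough⁺ {v} {S} {T′} e =
      subst (λ B → ∃[ y ] (T′ ≐ B + y ⟨ v ⟩²)) (sym (base-lineThrough v S))
        (_ , ≐-trans (≐-inverse (move-≐ v (- ent S (pivot v) (pivot v)) S)) e)

    ≐-refl : ∀ {v : Dir n} (S : Point n) → S ≐ S + 0# ⟨ v ⟩²
    ≐-refl S = mk≐ λ i j → sym (trans (cong (ent S i j +′_) (zeroˡ _)) (+-identityʳ _))

    self-on : ∀ (v : Dir n) (S : Point n) → On (lineThrough v S) S
    self-on v S = on-lineThrough⁺ (≐-refl S)

    base-on : ∀ L → On L (base L)
    base-on L = 0# , ≐-refl (base L)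

    1≢0 : 1# ≢ 0#
    1≢0 = 0≢1 ∘ sym

    move-≢ : ∀ (v : Dir n) (S : Point n) → move v 1# S ≢ S
    move-≢ v S e = 1≢0 (+-cancelˡ _ _ _ (trans (sym (≐-pivot (move-≐ v 1# S)))
      (trans (cong (λ U → ent U (pivot v) (pivot v)) e) (sym (+-identityʳ _)))))
    -- The step from S to T′ has some direction w; adjacency to S′ as well forces w = v. Maximality
    -- of the parametrised sets and completeness of their list both rest on this.
    adjacent-to-two⇒on : ∀ {v : Dir n} {a : F} (S S′ T′ : Point n) → a ≢ 0# → S′ ≐ S + a ⟨ v ⟩² →
      Adjacent T′ S → Adjacent T′ S′ → ∃[ x ] (T′ ≐ S + x ⟨ v ⟩²)
    adjacent-to-two⇒on S S′ T′ a≢0 e adj adj′ =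
      let w , b , b≢0 , f = adjacent⇒≐ T′ S adj
          u , t , g = adjacent⇒outer T′ S′ adj′
      in b , subst (λ w → T′ ≐ S + b ⟨ w ⟩²) (triangle-direction u t a≢0 b≢0 e f g) f

    on-isLine : ∀ L → IsLine (on L)
    on-isLine L = pairwise , maximal
      where
      pairwise : ∀ S S′ → on L S ≡ true → on L S′ ≡ true → S ≢ S′ → Adjacent S S′
      pairwise S S′ p p′ S≢S′ =
        ≐⇒adjacent (≐-trans (≐-inverse (proj₂ (on⁻ L S′ p′))) (proj₂ (on⁻ L S p))) S≢S′
      maximal : ∀ T′ → on L T′ ≡ false → ¬ (∀ S → on L S ≡ true → Adjacent T′ S)
      -- Adjacency to two points of the line, those at offsets 0 and 1, already puts `T′` on it.
      maximal T′ off-L adj = Boolₚ.not-¬ off-L (on⁺ L T′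
          (adjacent-to-two⇒on B B₁ T′ 1≢0 e₁ (adj B (on⁺ L B (base-on L))) (adj B₁ (on⁺ L B₁ (1# , e₁)))))
        where
        B = base L
        B₁ = move (dir L) 1# B
        e₁ = move-≐ (dir L) 1# B

    -- Two points of L, its base and the one at offset 1, also lie on L′. Their difference fixes the
    -- direction, and then the common base point fixes the code.
    on-injective : ∀ L L′ → (∀ S → on L S ≡ on L′ S) → L ≡ L′
    on-injective L L′ e = begin
      L                         ≡⟨ lineThrough-base L (base-on L) ⟨
      lineThrough (dir L) B     ≡⟨ cong (λ v → lineThrough v B) same-dir ⟨
      lineThrough (dir L′) B    ≡⟨ lineThrough-base L′ B-on ⟩
      L′                        ∎
      where
      open ≡-Reasoning
      B = base L
      B₁ = move (dir L) 1# B
      e₁ = move-≐ (dir L) 1# B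
      B-on : On L′ B
      B-on = on⁻ L′ B (trans (sym (e B)) (on⁺ L B (base-on L)))
      B₁-on : On L′ B₁
      B₁-on = on⁻ L′ B₁ (trans (sym (e B₁)) (on⁺ L B₁ (1# , e₁)))
      f : B₁ ≐ B + _ ⟨ dir L′ ⟩²
      f = ≐-trans (≐-inverse (proj₂ B-on)) (proj₂ B₁-on)
      same-dir : dir L′ ≡ dir L
      same-dir = triangle-direction (λ _ → 0#) (λ _ → 0#) 1≢0 (λ z → move-≢ (dir L) B (≐-zero z f)) e₁ f
        (λ i j → sym (trans (cong (ent B₁ i j +′_) (zeroˡ 0#)) (+-identityʳ _)))

    anyPoint? : {P : Point n → Set} → (∀ S → Dec (P S)) → Dec (∃ P)
    anyPoint? {P} P? = map′ (λ (i , p) → from i , p)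
      (λ (S , p) → to S , subst P (sym (strictlyInverseʳ S)) p) (Finₚ.any? (P? ∘ from))
      where open Inverse (Point↔ n)

    _≟ₚ_ : (S S′ : Point n) → Dec (S ≡ S′)
    S ≟ₚ S′ = map′ point-ext (λ { refl i j → refl }) (Finₚ.all? λ i → Finₚ.all? λ j → _ Finₚ.≟ _)

    -- The empty set is not maximal: the zero matrix is vacuously adjacent to all its points.
    line-nonempty : ∀ P → IsLine P → ∃[ S ] (P S ≡ true)
    line-nonempty P (_ , maximal) with anyPoint? (λ S → P S Boolₚ.≟ true)
    ... | yes p = p
    ... | no ¬p = ⊥-elim (maximal O (Boolₚ.¬-not (λ t → ¬p (O , t)))
                    (λ S t → ⊥-elim (¬p (S , t))))
      where O = symPoint (λ _ _ → 0#) (λ _ _ → refl)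

    -- A singleton is not maximal, since S + v vᵀ is adjacent to S. The index provides a direction
    -- v; for n = 0 there is none and the single point is a line by itself.
    line-second-point : Fin n → ∀ P → IsLine P → ∀ S → P S ≡ true → ∃[ S′ ] (P S′ ≡ true × S′ ≢ S)
    line-second-point i P (_ , maximal) S PS
      with anyPoint? (λ S′ → (P S′ Boolₚ.≟ true) ×-dec ¬? (S′ ≟ₚ S))
    ... | yes p = p
    ... | no ¬p = ⊥-elim (maximal S₁ (Boolₚ.¬-not (λ t → ¬p (S₁ , t , move-≢ v S))) adj)
      where
      v = axis i
      S₁ = move v 1# S
      adj : ∀ S′ → P S′ ≡ true → Adjacent S₁ S′
      adj S′ t with S′ ≟ₚ S
      ... | yes refl = ≐⇒adjacent (move-≐ v 1# S) (move-≢ v S)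
      ... | no S′≢S = ⊥-elim (¬p (S′ , t , S′≢S))

    -- Every point of P is S, S′ or adjacent to both, hence on the line through them. A point of
    -- that line outside P would be adjacent to all of P, against the maximality of P.
    through-two-points : ∀ P → IsLine P → (S S′ : Point n) → P S ≡ true → P S′ ≡ true →
      ∀ {v : Dir n} {a} → a ≢ 0# → S′ ≐ S + a ⟨ v ⟩² → ∀ U → P U ≡ on (lineThrough v S) U
    through-two-points P (pairwise , maximal) S S′ PS PS′ {v} a≢0 e = same
      where
      L = lineThrough v S
      P⇒L : ∀ U → P U ≡ true → on L U ≡ true
      P⇒L U PU with U ≟ₚ S | U ≟ₚ S′
      ... | yes U≡S | _ = on⁺ L U (subst (On L) (sym U≡S) (self-on v S))
      ... | no _ | yes U≡S′ = on⁺ L U (subst (On L) (sym U≡S′) (on-lineThrough⁺ e))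
      ... | no U≢S | no U≢S′ = on⁺ L U (on-lineThrough⁺ (proj₂
              (adjacent-to-two⇒on S S′ U a≢0 e (pairwise U S PU PS U≢S) (pairwise U S′ PU PS′ U≢S′))))
      same : ∀ U → P U ≡ on L U
      same U with P U in PU
      ... | true = sym (P⇒L U PU)
      ... | false = sym (Boolₚ.¬-not λ LU → maximal U PU λ W PW →
              proj₁ (on-isLine L) U W LU (P⇒L W PW)
                (λ U≡W → Boolₚ.not-¬ PU (trans (cong P U≡W) PW)))

    isLine⇒on : Fin n → ∀ P → IsLine P → ∃[ L ] (∀ S → P S ≡ on L S)
    isLine⇒on i P isLine =
      let S , PS = line-nonempty P isLine
          S′ , PS′ , S′≢S = line-second-point i P isLine S PS
          v , a , a≢0 , e = adjacent⇒≐ S′ S (proj₁ isLine S′ S PS′ PS S′≢S)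
      in lineThrough v S , through-two-points P isLine S S′ PS PS′ a≢0 e

    line : Fin (#Line n) → Point n → Bool
    line = on ∘ Inverse.from (LineCode↔ n)

    line-enumeration : Fin n → IsLineEnumeration (#Line n) line
    line-enumeration i₀ = (λ i → on-isLine (from i)) ,
      (λ i j e → trans (sym (strictlyInverseˡ i))
        (trans (cong to (on-injective (from i) (from j) e)) (strictlyInverseˡ j))) ,
      (λ P isLine → let L , e = isLine⇒on i₀ P isLine in
        to L , λ S → trans (e S) (cong (λ L → on L S) (sym (strictlyInverseʳ L))))
      where open Inverse (LineCode↔ n)

  -- Sums over the list of all points

  ∈-allVecs : {A : Set} {xs : List A} → (∀ x → x ∈ xs) → ∀ {k} (v : Vec A k) → v ∈ allVecs k xs
  ∈-allVecs all [] = here refl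
  ∈-allVecs {xs = xs} all (x ∷ v) =
    ∈ₚ.∈-concatMap⁺ (λ x → L.map (x ∷_) (allVecs _ xs))
      (Any.map (λ { refl → ∈ₚ.∈-map⁺ (x ∷_) (∈-allVecs all v) }) (all x))

  allVecs-unique : {A : Set} {xs : List A} → Unique xs → ∀ k → Unique (allVecs k xs)
  allVecs-unique u zero = [] ∷ []
  allVecs-unique {xs = xs} u (suc k) = Uniqueₚ.concat⁺
    (Allₚ.map⁺ (All.universal (λ x → Uniqueₚ.map⁺ Vecₚ.∷-injectiveʳ (allVecs-unique u k)) xs))
    (AllPairsₚ.map⁺ (AllPairs.map
      (λ x≢y {_} p → x≢y (heads (proj₁ p) (proj₂ p))) u))
    where
    heads : ∀ {x y v} → v ∈ L.map (x ∷_) (allVecs k xs) → v ∈ L.map (y ∷_) (allVecs k xs) → x ≡ y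
    heads p p′ with ∈ₚ.∈-map⁻ (_ ∷_) p | ∈ₚ.∈-map⁻ (_ ∷_) p′
    ... | _ , _ , refl | _ , _ , e = Vecₚ.∷-injectiveˡ e

  -- Matrices that are not symmetric contribute `false`, so a sum over points becomes one over all
  -- matrices, where absence of repetitions is easy to check.
  xorSum-mapMaybe : {A B : Set} (f : A → Maybe B) (g : B → Bool) (xs : List A) →
    xorSum (mapMaybe f xs) g ≡ xorSum xs (maybe′ g false ∘ f)
  xorSum-mapMaybe f g [] = refl
  xorSum-mapMaybe f g (x ∷ xs) with f x
  ... | just y  = cong (g y xor_) (xorSum-mapMaybe f g xs)
  ... | nothing = xorSum-mapMaybe f g xs

  -- toPoint calls an unnamed auxiliary function on isSymᵇ M and refl : isSymᵇ M ≡ isSymᵇ M,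
  -- and abstracting isSymᵇ M alone is ill-typed. Replacing refl by equation c for a variable c,
  -- whose type mentions the left-hand side only through M, makes the abstraction well-typed.
  data SymTest {n} (M : Mat n n) (b : Bool) : Set where
    result : isSymᵇ M ≡ b → SymTest M b

  equation : ∀ {n} {M : Mat n n} {b} → SymTest M b → isSymᵇ M ≡ b
  equation (result e) = e

  data EquationView {n} {M : Mat n n} {b} : isSymᵇ M ≡ b → Set where
    equation-of : (c : SymTest M b) → EquationView (equation c)

  equationView : ∀ {n} (M : Mat n n) {b} (e : isSymᵇ M ≡ b) → EquationView {n} {M} e
  equationView M e = equation-of (result e)

  toPoint-spec : ∀ {n} (M : Mat n n) →
    (∃[ S ] (proj₁ S ≡ M × toPoint M ≡ just S)) ⊎ (¬ T (isSymᵇ M) × toPoint M ≡ nothing)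
  toPoint-spec {n} M with refl {x = isSymᵇ M}
  ... | e with equationView M e
  toPoint-spec {n} M | _ | equation-of c with isSymᵇ M
  toPoint-spec {n} M | _ | equation-of c | true  = inj₁ (_ , refl , refl)
  toPoint-spec {n} M | _ | equation-of c | false = inj₂ (id , refl)

  xorSum-allPoints : ∀ {n} {f : Point n → Bool} (S : Point n) →
    (∀ T′ → T′ ≢ S → f T′ ≡ false) → xorSum (allPoints n) f ≡ f S
  xorSum-allPoints {n} {f} S off-S = begin
    xorSum (allPoints n) f   ≡⟨ xorSum-mapMaybe toPoint f (allMats n) ⟩
    xorSum (allMats n) g     ≡⟨ xorSum-single (allMats n) (proj₁ S)
                                  (allVecs-unique (allVecs-unique (Uniqueₚ.allFin⁺ q) n) n)
                                  (∈-allVecs (∈-allVecs ∈ₚ.∈-allFin) (proj₁ S)) off-M ⟩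
    g (proj₁ S)              ≡⟨ g-S ⟩
    f S                      ∎
    where
    open ≡-Reasoning
    g : Mat n n → Bool
    g M = maybe′ f false (toPoint M)
    g-S : g (proj₁ S) ≡ f S
    g-S with toPoint-spec (proj₁ S)
    ... | inj₂ (asym , _) = ⊥-elim (asym (proj₂ S))
    ... | inj₁ (S′ , S′≡ , e) = trans (cong (maybe′ f false) e)
          (cong f (point-ext (λ i j → cong (λ M → entry M i j) S′≡)))
    off-M : ∀ M → M ≢ proj₁ S → g M ≡ false
    off-M M M≢S with toPoint-spec M
    ... | inj₂ (_ , e) = cong (maybe′ f false) e
    ... | inj₁ (S′ , S′≡ , e) = trans (cong (maybe′ f false) e)
          (off-S S′ (λ S′≡S → M≢S (trans (sym S′≡) (cong proj₁ S′≡S))))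

-- First zeros on the diagonal and triangular incidence

lookup-injective : {A : Set} {xs : List A} → Unique xs →
  ∀ i j → L.lookup xs i ≡ L.lookup xs j → i ≡ j
lookup-injective (_ ∷ _)  zero    zero    e = refl
lookup-injective (x∉ ∷ _) zero    (suc j) e = ⊥-elim (All.lookup x∉ (∈ₚ.∈-lookup j) e)
lookup-injective (x∉ ∷ _) (suc i) zero    e = ⊥-elim (All.lookup x∉ (∈ₚ.∈-lookup i) (sym e))
lookup-injective (_ ∷ u)  (suc i) (suc j) e = cong suc (lookup-injective u i j e)

firstOrNone : {n : ℕ} {P : Fin n → Set} → (∀ i → Dec (P i)) →
  (∀ i → ¬ P i) ⊎ (∃[ i ] (P i × ∀ j → j Fin.< i → ¬ P j))
firstOrNone {zero} P? = inj₁ λ ()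
firstOrNone {suc n} P? with P? zero
... | yes p = inj₂ (zero , p , λ _ ())
... | no ¬p with firstOrNone (P? ∘ suc)
...   | inj₁ none = inj₁ λ { zero → ¬p ; (suc i) → none i }
...   | inj₂ (i , p , before) =
        inj₂ (suc i , p , λ { zero _ → ¬p ; (suc j) (s≤s j<i) → before j j<i })

module Codes {q′ : ℕ} (𝔽 : FieldOn (suc q′)) (n : ℕ) where
  open FieldOn 𝔽 renaming (_+_ to infixl 6 _+′_)
  open Matrices 𝔽
  open Geometry 𝔽
  open Lines 𝔽
  open _≐_+_⟨_⟩²
  open CommutativeRing R using (+-identityˡ; +-identityʳ; zeroˡ; zeroʳ; *-identityʳ)

  m : ℕ
  m = #Line n

  Ln : Fin m → Point n → Bool
  Ln = line

  NonzeroDiagonal : Point n → Set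
  NonzeroDiagonal S = ∀ i → ent S i i ≢ 0#

  FirstZero : Point n → Fin n → Set
  FirstZero S i = ent S i i ≡ 0# × (∀ j → j Fin.< i → ent S j j ≢ 0#)

  abstract
    -- When the first zero of S is at i, this is the index of ℓ(S).
    axisLine : Fin n → Point n → Fin m
    axisLine i S = Inverse.to (LineCode↔ n) (lineThrough (axis i) S)

    Ln-axisLine⁻ : ∀ i S T′ → Ln (axisLine i S) T′ ≡ true → ∃[ x ] (T′ ≐ S + x ⟨ axis i ⟩²)
    Ln-axisLine⁻ i S T′ e = on-lineThrough⁻ {v = axis i} {S} {T′} (on⁻ (lineThrough (axis i) S) T′
      (trans (cong (λ L → on L T′) (sym (Inverse.strictlyInverseʳ (LineCode↔ n) (lineThrough (axis i) S)))) e))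

    Ln-axisLine-self : ∀ i S → Ln (axisLine i S) S ≡ true
    Ln-axisLine-self i S =
      trans (cong (λ L → on L S) (Inverse.strictlyInverseʳ (LineCode↔ n) (lineThrough (axis i) S)))
            (on⁺ (lineThrough (axis i) S) S (self-on (axis i) S))

  module _ {i : Fin n} {x : F} {S T′ : Point n} (e : T′ ≐ S + x ⟨ axis i ⟩²) where

    axis-fixed : ∀ j → j ≢ i → ent T′ j j ≡ ent S j j
    axis-fixed j j≢i = trans (at e j j) (trans
      (cong (ent S j j +′_) (trans (cong (λ z → x · (z · z)) (vec-axis-≢ i j j≢i))
        (trans (cong (x ·_) (zeroˡ 0#)) (zeroʳ x))))
      (+-identityʳ (ent S j j)))

    axis-moved : ent S i i ≡ 0# → ent T′ i i ≡ x
    axis-moved z = trans (at e i i) (trans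
      (cong₂ _+′_ z (trans (cong (λ z → x · (z · z)) (vec-axis-≡ i))
        (trans (cong (x ·_) (*-identityʳ 1#)) (*-identityʳ x))))
      (+-identityˡ x))

  data DiagonalView (S : Point n) : Set where
    nonzero   : NonzeroDiagonal S → DiagonalView S
    firstZero : ∀ i → FirstZero S i → DiagonalView S

  diagonalView : ∀ S → DiagonalView S
  diagonalView S with firstOrNone (λ i → ent S i i Finₚ.≟ 0#)
  ... | inj₁ nz      = nonzero nz
  ... | inj₂ (i , z) = firstZero i z

  -- Along this line only diagonal entry i varies: the earlier ones stay nonzero, and entry i equals
  -- the offset from S, which is zero only at S itself.
  later-zero : ∀ (S T′ : Point n) {i} → FirstZero S i → Ln (axisLine i S) T′ ≡ true → T′ ≢ S →
    ∀ j → j Fin.≤ i → ent T′ j j ≢ 0#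
  later-zero S T′ {i} (Sᵢᵢ≡0 , before) on-line T′≢S j j≤i with Ln-axisLine⁻ i S T′ on-line | j Finₚ.≟ i
  ... | x , e | yes refl = λ z → T′≢S (≐-zero (trans (sym (axis-moved e Sᵢᵢ≡0)) z) e)
  ... | x , e | no j≢i = λ z →
        before j (Finₚ.≤∧≢⇒< j≤i j≢i) (trans (sym (axis-fixed e j j≢i)) z)

  -- In the check equation of ℓ(S) every other point has a nonzero diagonal or a later first zero,
  -- so induction from the last position downwards leaves c S alone.
  codeword-vanishes : ∀ c → CodeC Ln c → (∀ S → NonzeroDiagonal S → c S ≡ false) →
    ∀ S → c S ≡ false
  codeword-vanishes c Cc vanish S with diagonalView S
  ... | nonzero nz = vanish S nz
  ... | firstZero i z = go i (>-wellFounded i) S z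
    where
    go : ∀ i → Acc Fin._>_ i → ∀ S → FirstZero S i → c S ≡ false
    go i (acc rec) S z = trans (sym (cong (_∧ c S) (Ln-axisLine-self i S)))
      (trans (sym (xorSum-allPoints S others)) (Cc (axisLine i S)))
      where
      others : ∀ T′ → T′ ≢ S → Ln (axisLine i S) T′ ∧ c T′ ≡ false
      others T′ T′≢S with Ln (axisLine i S) T′ in on-line | diagonalView T′
      ... | false | _ = refl
      ... | true | nonzero nz = vanish T′ nz
      ... | true | firstZero k (z′ , before) = go k (rec (ℕₚ.≰⇒> λ k≤i →
              later-zero S T′ z on-line T′≢S k k≤i z′)) T′ (z′ , before)

  -- `later-zero` read from the point S on ℓ(S′): this is the triangularity in the order that Cᵀ
  -- needs.
  axisLine-overlap : ∀ (S S′ : Point n) {i j} → FirstZero S i → FirstZero S′ j → Ln (axisLine j S′) S ≡ true →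
    j Fin.≤ i × (j ≡ i → S ≡ S′)
  axisLine-overlap S S′ {i} {j} z z′ on-line with S ≟ₚ S′
  ... | yes refl = ℕₚ.≮⇒≥ (λ i<j → proj₂ z′ i i<j (proj₁ z)) , λ _ → refl
  ... | no S≢S′ = ℕₚ.≮⇒≥ (λ i<j → later-zero S′ S z′ on-line S≢S′ i (ℕₚ.<⇒≤ i<j) (proj₁ z)) ,
        λ { refl → ⊥-elim (later-zero S′ S z′ on-line S≢S′ i ℕₚ.≤-refl (proj₁ z)) }

  -- The dimension bound for C

  NonzeroCode : Set
  NonzeroCode = Vec (Fin q′) n × Off n

  #Nonzero : ℕ
  #Nonzero = q′ ^ n * q ^ tri n

  NonzeroCode↔ : NonzeroCode ↔ Fin #Nonzero
  NonzeroCode↔ = ×-↔-Fin* (Vec↔Fin^ n) (Off↔ n)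

  -- `punchIn 0#` enumerates the nonzero field elements by `Fin q′`, wherever zero sits in `Fin q`.
  nonzeroPoint : NonzeroCode → Point n
  nonzeroPoint (u , o) = build (V.map (punchIn 0#) u) o

  nonzeroPoint-surjective : ∀ S → NonzeroDiagonal S → ∃[ g ] (nonzeroPoint g ≡ S)
  nonzeroPoint-surjective S nz = (u , off S) ,
    trans (cong (λ d → build d (off S)) (vec-ext {v = V.map (punchIn 0#) u} {w = diag S} diag≡)) (build-diag-off S)
    where
    u : Vec (Fin q′) n
    u = tabulate (λ i → punchOut (nz i ∘ sym))
    diag≡ : ∀ i → lookup (V.map (punchIn 0#) u) i ≡ lookup (diag S) i
    diag≡ i = begin
      lookup (V.map (punchIn 0#) u) i        ≡⟨ Vecₚ.lookup-map i (punchIn 0#) u ⟩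
      punchIn 0# (lookup u i)                ≡⟨ cong (punchIn 0#) (Vecₚ.lookup∘tabulate _ i) ⟩
      punchIn 0# (punchOut (nz i ∘ sym))     ≡⟨ Finₚ.punchIn-punchOut (nz i ∘ sym) ⟩
      ent S i i                              ≡⟨ Vecₚ.lookup∘tabulate _ i ⟨
      lookup (diag S) i                      ∎
      where open ≡-Reasoning

  CodeC-linear : IsLinearCode (CodeC Ln)
  CodeC-linear = kernel-linear (allPoints n) Ln

  CodeC-dimension : ∃[ k ] (HasDimension (CodeC Ln) k × k ≤ #Nonzero)
  CodeC-dimension =
    let k , dim , k≤ = infoSet⇒dimension (Point↔ n) (CodeC Ln) CodeC-linear
                         (λ c → Finₚ.all? λ i → _ Boolₚ.≟ false) nonzeroPoints info
    in k , dim , subst (k ≤_) (Listₚ.length-tabulate nonzeroPointᵢ) k≤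
    where
    open Inverse NonzeroCode↔
    nonzeroPointᵢ : Fin #Nonzero → Point n
    nonzeroPointᵢ = nonzeroPoint ∘ from
    nonzeroPoints : List (Point n)
    nonzeroPoints = L.tabulate nonzeroPointᵢ
    info : ∀ c → CodeC Ln c → (∀ S → S ∈ nonzeroPoints → c S ≡ false) → ∀ S → c S ≡ false
    info c Cc vanish = codeword-vanishes c Cc λ S nz →
      let g , e = nonzeroPoint-surjective S nz
      in vanish S (subst (_∈ nonzeroPoints) (trans (cong nonzeroPoint (strictlyInverseʳ g)) e)
                     (∈ₚ.∈-tabulate⁺ (to g)))

  -- The dimension bound for Cᵀ

  -- Labels S by ℓ(S), or by its code if ℓ(S) does not exist. Injectivity of this labelling counts
  -- the chosen lines without an explicit list of the points with a zero.
  mark : Point n → Fin m ⊎ NonzeroCode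
  mark S with diagonalView S
  ... | nonzero nz    = inj₂ (proj₁ (nonzeroPoint-surjective S nz))
  ... | firstZero i _ = inj₁ (axisLine i S)

  mark-inj₁ : ∀ S {l} → mark S ≡ inj₁ l → ∃[ i ] (FirstZero S i × axisLine i S ≡ l)
  mark-inj₁ S e with diagonalView S
  mark-inj₁ S refl | firstZero i z = i , z , refl

  mark-inj₂ : ∀ S {g} → mark S ≡ inj₂ g → nonzeroPoint g ≡ S
  mark-inj₂ S e with diagonalView S
  mark-inj₂ S refl | nonzero nz = proj₂ (nonzeroPoint-surjective S nz)

  -- If ℓ(S) = ℓ(S′), each point lies on the line of the other, so their first zeros agree and the
  -- points coincide.
  mark-injective : ∀ S S′ → mark S ≡ mark S′ → S ≡ S′
  mark-injective S S′ e = go (mark S) refl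
    where
    go : ∀ r → mark S ≡ r → S ≡ S′
    go (inj₂ g) p = trans (sym (mark-inj₂ S p)) (mark-inj₂ S′ (trans (sym e) p))
    go (inj₁ l) p with mark-inj₁ S p | mark-inj₁ S′ (trans (sym e) p)
    ... | i , z , l≡ | j , z′ , l≡′ =
      let j≤i , S≡ = axisLine-overlap S S′ z z′
            (subst (λ l → Ln l S ≡ true) (trans l≡ (sym l≡′)) (Ln-axisLine-self i S))
          i≤j , _ = axisLine-overlap S′ S z′ z
            (subst (λ l → Ln l S′ ≡ true) (trans l≡′ (sym l≡)) (Ln-axisLine-self j S′))
      in S≡ (Finₚ.toℕ-injective (ℕₚ.≤-antisym j≤i i≤j))

  Selected : Fin m → Set
  Selected l = ∃[ S ] (mark S ≡ inj₁ l)

  selected? : ∀ l → Dec (Selected l)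
  selected? l = anyPoint? (λ S → is-l? (mark S))
    where
    is-l? : ∀ r → Dec (r ≡ inj₁ l)
    is-l? (inj₁ l′) = map′ (cong inj₁) inj₁-injective (l′ Finₚ.≟ l)
    is-l? (inj₂ g)  = no λ ()

  unselected : List (Fin m)
  unselected = L.filter (¬? ∘ selected?) (allFin m)

  -- Unselected lines are never labels, so they can be added to the points without losing
  -- injectivity. Comparing sizes gives the bound free of subtraction.
  unselected-bound : length unselected + q ^ (n + tri n) ≤ m + #Nonzero
  unselected-bound = injective⇒size≤ {A = Fin (length unselected) ⊎ Point n}
    (↔-trans (↔-refl ⊎-↔ Point↔ n) (↔-sym Finₚ.+↔⊎))
    (↔-trans (↔-refl ⊎-↔ NonzeroCode↔) (↔-sym Finₚ.+↔⊎))
    f f-injective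
    where
    f : Fin (length unselected) ⊎ Point n → Fin m ⊎ NonzeroCode
    f (inj₁ k) = inj₁ (L.lookup unselected k)
    f (inj₂ S) = mark S
    not-marked : ∀ k S → mark S ≢ inj₁ (L.lookup unselected k)
    not-marked k S e = proj₂ (∈ₚ.∈-filter⁻ (¬? ∘ selected?) {xs = allFin m} (∈ₚ.∈-lookup k)) (S , e)
    f-injective : ∀ {a b} → f a ≡ f b → a ≡ b
    f-injective {inj₁ k} {inj₁ k′} e = cong inj₁ (lookup-injective
      (Uniqueₚ.filter⁺ (¬? ∘ selected?) (Uniqueₚ.allFin⁺ m)) k k′ (inj₁-injective e))
    f-injective {inj₁ k} {inj₂ S} e = ⊥-elim (not-marked k S (sym e))
    f-injective {inj₂ S} {inj₁ k} e = ⊥-elim (not-marked k S e)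
    f-injective {inj₂ S} {inj₂ S′} e = cong inj₂ (mark-injective S S′ e)

  -- In the check equation of S the unselected lines vanish by assumption, and a selected line ℓ(S′)
  -- other than ℓ(S) has its first zero earlier, so induction upwards leaves only ℓ(S).
  dual-codeword-vanishes : ∀ c → CodeCT Ln c → (∀ l → l ∈ unselected → c l ≡ false) →
    ∀ l → c l ≡ false
  dual-codeword-vanishes c Cc vanish l with selected? l
  ... | no ¬sel = vanish l (∈ₚ.∈-filter⁺ (¬? ∘ selected?) (∈ₚ.∈-allFin l) ¬sel)
  ... | yes (S , e) with mark-inj₁ S e
  ...   | i , z , l≡ = trans (cong c (sym l≡)) (go i (<-wellFounded i) S z)
    where
    go : ∀ i → Acc Fin._<_ i → ∀ S → FirstZero S i → c (axisLine i S) ≡ false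
    go i (acc rec) S z = trans (sym (cong (_∧ c (axisLine i S)) (Ln-axisLine-self i S)))
      (trans (sym (xorSum-single (allFin m) (axisLine i S) (Uniqueₚ.allFin⁺ m)
        (∈ₚ.∈-allFin (axisLine i S)) others)) (Cc S))
      where
      others : ∀ l → l ≢ axisLine i S → Ln l S ∧ c l ≡ false
      others l l≢ with Ln l S in on-line | selected? l
      ... | false | _ = refl
      ... | true | no ¬sel = vanish l (∈ₚ.∈-filter⁺ (¬? ∘ selected?) (∈ₚ.∈-allFin l) ¬sel)
      ... | true | yes (S′ , e) with mark-inj₁ S′ e
      ...   | j , z′ , refl with axisLine-overlap S S′ z z′ on-line | j Finₚ.≟ i
      ...     | _ , S≡ | yes refl = ⊥-elim (l≢ (cong (axisLine i) (sym (S≡ refl))))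
      ...     | j≤i , _ | no j≢i = go j (rec (Finₚ.≤∧≢⇒< j≤i j≢i)) S′ z′

  CodeCT-linear : IsLinearCode (CodeCT Ln)
  CodeCT-linear = kernel-linear (allFin m) (λ S l → Ln l S)

  CodeCT-dimension : ∃[ k ] (HasDimension (CodeCT Ln) k × k + q ^ (n + tri n) ≤ m + #Nonzero)
  CodeCT-dimension =
    let k , dim , k≤ = infoSet⇒dimension ↔-refl (CodeCT Ln) CodeCT-linear
                         allPoints? unselected dual-codeword-vanishes
    in k , dim , ℕₚ.≤-trans (ℕₚ.+-monoˡ-≤ (q ^ (n + tri n)) k≤) unselected-bound
    where
    open Inverse (Point↔ n)
    allPoints? : ∀ c → Dec (CodeCT Ln c)
    allPoints? c = map′ (λ h S → subst (λ S → xorSum (allFin m) (λ l → Ln l S ∧ c l) ≡ false)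
                                   (strictlyInverseʳ S) (h (to S)))
      (λ h i → h (from i)) (Finₚ.all? λ i → _ Boolₚ.≟ false)

-- Exponents and the main count

-- The n² positions of a matrix are the diagonal and two triangles.
tri-double : ∀ n → tri n * 2 + n ≡ n * n
tri-double zero    = refl
tri-double (suc n) = begin
  (n + tri n) * 2 + suc n        ≡⟨ solve 2 (λ n t → (n :+ t) :* con 2 :+ (con 1 :+ n) :=
                                      (t :* con 2 :+ n) :+ (con 1 :+ n :+ n)) refl n (tri n) ⟩
  (tri n * 2 + n) + (1 + n + n)  ≡⟨ cong (_+ (1 + n + n)) (tri-double n) ⟩
  n * n + (1 + n + n)            ≡⟨ solve 1 (λ n → n :* n :+ (con 1 :+ n :+ n) :=
                                      (con 1 :+ n) :* (con 1 :+ n)) refl n ⟩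
  suc n * suc n                  ∎
  where
  open ≡-Reasoning
  open +-*-Solver

half : ∀ {a} b → a ≡ b * 2 → a / 2 ≡ b
half b refl = m*n/n≡m b 2

point-exponent : ∀ n → (n * suc n) / 2 ≡ n + tri n
point-exponent n = half (n + tri n) (begin
  n * suc n                 ≡⟨ ℕₚ.*-suc n n ⟩
  n + n * n                 ≡⟨ cong (n +_) (tri-double n) ⟨
  n + (tri n * 2 + n)       ≡⟨ solve 2 (λ n t → n :+ (t :* con 2 :+ n) := (n :+ t) :* con 2) refl n (tri n) ⟩
  (n + tri n) * 2           ∎)
  where
  open ≡-Reasoning
  open +-*-Solver

off-exponent : ∀ n → (n * n ∸ n) / 2 ≡ tri n
off-exponent n = half (tri n)
  (trans (cong (_∸ n) (sym (tri-double n))) (ℕₚ.m+n∸n≡m (tri n * 2) n))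

-- Stated for positive size n = k + 1, where subtracting 2 does not truncate.
line-exponent : ∀ k → (suc k * suc k + suc k ∸ 2) / 2 ≡ k + tri (suc k)
line-exponent k = half (k + tri (suc k)) (begin
  suc k * suc k + suc k ∸ 2              ≡⟨ cong (λ s → s + suc k ∸ 2) (tri-double (suc k)) ⟨
  t * 2 + suc k + suc k ∸ 2              ≡⟨ cong (_∸ 2) (solve 2 (λ k t → t :* con 2 :+ (con 1 :+ k) :+ (con 1 :+ k) :=
                                              (k :+ t) :* con 2 :+ con 2) refl k t) ⟩
  (k + t) * 2 + 2 ∸ 2                    ≡⟨ ℕₚ.m+n∸n≡m ((k + t) * 2) 2 ⟩
  (k + t) * 2                            ∎)
  where
  open ≡-Reasoning
  open +-*-Solver
  t = tri (suc k)

theorem7 : (q n : ℕ) → IsPrimePower q → 0 < n → (𝔽 : FieldOn q) →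
    let open Matrices 𝔽 in
    (Point n ↔ Fin (q ^ ((n * suc n) / 2)))
    × Σ ℕ (λ m → Σ (Fin m → Point n → Bool) (λ Ln →
    IsLineEnumeration m Ln
    × m * (q ∸ 1) ≡ (q ^ n ∸ 1) * q ^ ((n * n + n ∸ 2) / 2)
    × IsLinearCode (CodeC Ln)
    × (∃[ k₁ ] (HasDimension (CodeC Ln) k₁
    × k₁ ≤ q ^ ((n * n ∸ n) / 2) * (q ∸ 1) ^ n))
    × IsLinearCode (CodeCT Ln)
    × (∃[ k₂ ] (HasDimension (CodeCT Ln) k₂
    × k₂ + q ^ ((n * suc n) / 2)
    ≤ m + q ^ ((n * n ∸ n) / 2) * (q ∸ 1) ^ n))))
theorem7 zero n _ _ 𝔽 with FieldOn.0# 𝔽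
... | ()
theorem7 (suc q′) (suc k) _ _ 𝔽
  -- The halved exponents of the statement become the `tri` exponents in which all the sets were
  -- counted.
  rewrite point-exponent (suc k) | off-exponent (suc k) | line-exponent k
        | ℕₚ.*-comm (suc q′ ^ tri (suc k)) (q′ ^ suc k)
  = Point↔ n , m , Ln , line-enumeration zero , line-count , CodeC-linear , CodeC-dimension ,
    CodeCT-linear , CodeCT-dimension
  where
  n = suc k
  open Geometry 𝔽
  open Lines 𝔽 using (line-enumeration)
  open Codes 𝔽 n
  line-count : m * q′ ≡ (q ^ n ∸ 1) * q ^ (k + tri n)
  line-count = begin
    #Dir n * (q ^ k * q ^ tri n) * q′   ≡⟨ cong (λ s → #Dir n * s * q′) (ℕₚ.^-distribˡ-+-* q k (tri n)) ⟨
    #Dir n * q ^ (k + tri n) * q′       ≡⟨ solve 3 (λ a b c → a :* b :* c := a :* c :* b) refl (#Dir n) _ q′ ⟩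
    #Dir n * q′ * q ^ (k + tri n)       ≡⟨ cong (λ s → (s ∸ 1) * q ^ (k + tri n)) (#Dir-formula n) ⟩
    (q ^ n ∸ 1) * q ^ (k + tri n)       ∎
    where
    open ≡-Reasoning
    open +-*-Solver
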